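{- Let $\Gamma$ be a distance-regular graph with classical parameters $(D,b,\alpha,\beta)$ such that $b\ge2$, $b-1\ge\alpha\ge1$ and $D\ge3$, geometric with respect to a set $\mathcal C$ of Delsarte cliques (so $\Gamma$ is the point graph of the partial linear space $(V(\Gamma),\mathcal C,\in)$; members of $\mathcal C$ are called lines). Let $r=[D]$. Assume $\Gamma$ satisfies the dual Pasch axiom. Let $\ell$ be a line, $M$ an assembly and $u$ a vertex not in $M$. Then: (1) if $\ell\cap M\ne\emptyset$, then $|\ell\cap M|=\alpha+1$; (2) if $u$ has a neighbour in $M$, then $u$ has exactly $\alpha+1$ neighbours in $M$ and exactly one line through $u$ intersects $M$. Consequently, for every vertex $x$ the local graph at $x$ is the $\alpha$-clique extension of a $\frac{\beta}{\alpha}\times r$-grid.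
   Context: Distance-regular graph with intersection numbers $b_i,c_i$, valency $k=b_0$. For integer $b\ne1$, $[j]=\frac{b^j-1}{b-1}$. Classical parameters $(D,b,\alpha,\beta)$: diameter $D$, $b_i=([D]-[i])(\beta-\alpha[i])$, $c_i=[i](1+\alpha[i-1])$. A Delsarte clique is a clique with $1+\frac{k}{ -\theta_{\min}}$ vertices, $\theta_{\min}$ the smallest adjacency eigenvalue; geometric with respect to $\mathcal C$ means every edge lies in exactly one member of $\mathcal C$. Dual Pasch axiom: for any two adjacent vertices $x,y$, the set of common neighbours of $x$ and $y$ not on the line through $x$ and $y$ is a clique. An assembly is a maximal clique of $\Gamma$ not in $\mathcal C$. The local graph at $x$ is the subgraph induced on the neighbours of $x$. The $m\times n$-grid is $K_m\Box K_n$; the $s$-clique extension of a graph $\Delta$ replaces each vertex $x$ by an $s$-clique $\tilde X$, with $u\in\tilde X$, $v\in\tilde Y$ ($\tilde X\ne\tilde Y$) adjacent iff $x\sim y$ in $\Delta$. -}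

module Defs where

open import Data.Bool.Base using (if_then_else_)
open import Data.Fin.Base using (Fin)
open import Data.Fin.Subset using (Subset; _∈_; _∉_; _⊆_; ∣_∣)
open import Data.Integer.Base as ℤ using (ℤ; +_; 1ℤ)
import Data.Integer.GCD as ℤ
import Data.Integer.Properties as ℤ
open import Data.Nat.Base as ℕ using (ℕ; suc)
open import Data.Product using (∃!; ∃-syntax; _×_; _,_)
open import Data.Rational.Base as ℚ using (ℚ; 0ℚ; 1ℚ)
import Data.Rational.Properties as ℚ
open import Data.Refinement using (Refinement-syntax; value)
open import Data.Sum.Base using (_⊎_; inj₁; inj₂)
open import Function.Base using (_∘_)
open import Function.Bundles using (_⇔_; _↔_; Inverse)
open import Level using (0ℓ)
open import Relation.Binary.Core using (Rel)
open import Relation.Binary.Definitions using (Decidable; Symmetric)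
open import Relation.Binary.PropositionalEquality
  using (_≡_; _≢_; refl; sym; trans; cong)
open import Relation.Nullary using (¬_; does)
open import Relation.Unary using (Pred)

open import Algebra.Properties.CommutativeMonoid.Sum ℚ.+-0-commutativeMonoid
  using (sum)

ℤ→ℚ : ℤ → ℚ
ℤ→ℚ i = i ℚ./ 1

ℕ→ℚ : ℕ → ℚ
ℕ→ℚ n = ℤ→ℚ (+ n)

ℤ→ℚ-nonZero : ∀ {i} → i ≢ ℤ.0ℤ → ℚ.NonZero (ℤ→ℚ i)
ℤ→ℚ-nonZero {i} i≢0 = ℚ.≢-nonZero {ℤ→ℚ i} λ eq → i≢0
  (trans (sym (ℚ.↥-/ i 1)) (cong (ℤ._* ℤ.gcd i 1ℤ) (ℚ.p≡0⇒↥p≡0 (ℤ→ℚ i) eq)))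

≥1⇒nonZero : ∀ {p} → 1ℚ ℚ.≤ p → ℚ.NonZero p
≥1⇒nonZero 1≤p = ℚ.>-nonZero (ℚ.<-≤-trans (ℚ.positive⁻¹ 1ℚ) 1≤p)

≥2⇒≢1 : ∀ {b} → + 2 ℤ.≤ b → b ≢ 1ℤ
≥2⇒≢1 (ℤ.+≤+ (ℕ.s≤s ())) refl

-- [ j ] = (bʲ - 1) / (b - 1)

gaussian : (b : ℤ) → .(b ≢ 1ℤ) → ℕ → ℚ
gaussian b b≢1 j =
  ℚ._÷_ (ℤ→ℚ (b ℤ.^ j ℤ.- 1ℤ)) (ℤ→ℚ (b ℤ.- 1ℤ))
    {{ℤ→ℚ-nonZero (b≢1 ∘ ℤ.i-j≡0⇒i≡j b 1ℤ)}}

-- Real numbers, as Cauchy sequences of rationals.  Ring operations on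
-- them are carried out termwise on the underlying sequences, so that the
-- relations below are defined for arbitrary rational sequences.

Seq : Set
Seq = ℕ → ℚ

record ℝ : Set where
  field
    seq    : Seq
    cauchy : ∀ ε → 0ℚ ℚ.< ε → ∃[ N ] ∀ m n → N ℕ.≤ m → N ℕ.≤ n →
             ℚ.∣ seq m ℚ.- seq n ∣ ℚ.< ε

open ℝ public using (seq)

infix 4 _≈ʳ_ _≤ʳ_ _#ʳ_

_≈ʳ_ : Rel Seq 0ℓ
x ≈ʳ y = ∀ ε → 0ℚ ℚ.< ε → ∃[ N ] ∀ n → N ℕ.≤ n → ℚ.∣ x n ℚ.- y n ∣ ℚ.< ε

_≤ʳ_ : Rel Seq 0ℓ
x ≤ʳ y = ∀ ε → 0ℚ ℚ.< ε → ∃[ N ] ∀ n → N ℕ.≤ n → x n ℚ.< y n ℚ.+ ε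

-- Apartness: the constructive form of "x and y are different".

_#ʳ_ : Rel Seq 0ℓ
x #ʳ y = ∃[ ε ] 0ℚ ℚ.< ε × ∃[ N ] ∀ n → N ℕ.≤ n → ε ℚ.≤ ℚ.∣ x n ℚ.- y n ∣

const : ℚ → Seq
const q _ = q

record Graph (V : Set) : Set₁ where
  infix 4 _~_
  field
    _~_      : Rel V 0ℓ
    ~-sym    : Symmetric _~_
    ~-irrefl : ∀ {x} → ¬ (x ~ x)

record _≅_ {V W : Set} (G : Graph V) (H : Graph W) : Set where
  private
    module G = Graph G
    module H = Graph H
  field
    bijection : V ↔ W
  open Inverse bijection using (to)
  field
    adjacency : ∀ x y → (x G.~ y) ⇔ (to x H.~ to y)

-- Membership proofs in a refinement type are irrelevant, so its elements
-- are exactly the vertices satisfying P.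

induced : ∀ {V} → Graph V → (P : Pred V 0ℓ) → Graph [ x ∈ V ∣ P x ]
induced G P = record
  { _~_      = λ x y → value x ~ value y
  ; ~-sym    = ~-sym
  ; ~-irrefl = ~-irrefl
  } where open Graph G

localGraph : ∀ {V} (G : Graph V) (x : V) → Graph [ y ∈ V ∣ Graph._~_ G x y ]
localGraph G x = induced G (Graph._~_ G x)

complete : ∀ m → Graph (Fin m)
complete m = record
  { _~_      = _≢_
  ; ~-sym    = λ x≢y → x≢y ∘ sym
  ; ~-irrefl = λ x≢x → x≢x refl
  }

_□_ : ∀ {V W} → Graph V → Graph W → Graph (V × W)
G □ H = record
  { _~_      = λ (x , y) (x′ , y′) → (x ≡ x′ × y H.~ y′) ⊎ (x G.~ x′ × y ≡ y′)
  ; ~-sym    = λ { (inj₁ (p , e)) → inj₁ (sym p , H.~-sym e)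
                 ; (inj₂ (e , p)) → inj₂ (G.~-sym e , sym p) }
  ; ~-irrefl = λ { (inj₁ (_ , e)) → H.~-irrefl e
                 ; (inj₂ (e , _)) → G.~-irrefl e }
  }
  where
  module G = Graph G
  module H = Graph H

grid : ∀ m n → Graph (Fin m × Fin n)
grid m n = complete m □ complete n

cliqueExtension : ∀ {V} (s : ℕ) → Graph V → Graph (V × Fin s)
cliqueExtension s G = record
  { _~_      = λ (x , i) (y , j) → x ~ y ⊎ (x ≡ y × i ≢ j)
  ; ~-sym    = λ { (inj₁ e)       → inj₁ (~-sym e)
                 ; (inj₂ (p , q)) → inj₂ (sym p , q ∘ sym) }
  ; ~-irrefl = λ { (inj₁ e)       → ~-irrefl e
                 ; (inj₂ (_ , q)) → q refl }
  } where open Graph G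

module _ {V : Set} (G : Graph V) where
  open Graph G

  data Walk : ℕ → V → V → Set where
    []  : ∀ {x} → Walk 0 x x
    _∷_ : ∀ {x y z l} → x ~ y → Walk l y z → Walk (suc l) x z

  -- Distance x y i: the distance between x and y is (defined and) i.

  Distance : V → V → ℕ → Set
  Distance x y i = Walk i x y × (∀ j → Walk j x y → i ℕ.≤ j)

record FiniteGraph (n : ℕ) : Set₁ where
  field
    graph : Graph (Fin n)
  open Graph graph public
  infix 4 _~?_
  field
    _~?_  : Decidable _~_

infix 4 _HasSize_

_HasSize_ : ∀ {n} → Pred (Fin n) 0ℓ → ℕ → Set
P HasSize k = ∃[ S ] (∀ x → (x ∈ S) ⇔ P x) × ∣ S ∣ ≡ k

module _ {n : ℕ} (Γ : FiniteGraph n) where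
  open FiniteGraph Γ

  record IsDistanceRegular : Set where
    field
      diameter  : ℕ
      bounded   : ∀ x y → ∃[ i ] i ℕ.≤ diameter × Distance graph x y i
      attained  : ∃[ x ] ∃[ y ] Distance graph x y diameter
      -- Intersection numbers.  The values b i for i > diameter, c 0, and
      -- c i for i > diameter carry no information.
      b c       : ℕ → ℕ
      b-counts  : ∀ {x y i} → Distance graph x y i →
                  (λ z → y ~ z × Distance graph x z (suc i)) HasSize b i
      c-counts  : ∀ {x y i} → Distance graph x y (suc i) →
                  (λ z → y ~ z × Distance graph x z i) HasSize c (suc i)

    valency : ℕ
    valency = b 0

  -- Rational α and β suffice when D ≥ 2 and b ≥ 2: c₂ = (1 + b) (1 + α) and
  -- b₀ = [ D ] β are integers.

  record HasClassicalParameters (dr : IsDistanceRegular)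
                                (D : ℕ) (b : ℤ) (α β : ℚ) : Set where
    private
      module I = IsDistanceRegular dr
    field
      diameter≡D : I.diameter ≡ D
      b≢1        : b ≢ 1ℤ
    private
      [_] : ℕ → ℚ
      [_] = gaussian b b≢1
    field
      b-formula  : ∀ i → i ℕ.≤ D →
                   ℕ→ℚ (I.b i) ≡ ([ D ] ℚ.- [ i ]) ℚ.* (β ℚ.- α ℚ.* [ i ])
      c-formula  : ∀ i → suc i ℕ.≤ D →
                   ℕ→ℚ (I.c (suc i)) ≡ [ suc i ] ℚ.* (1ℚ ℚ.+ α ℚ.* [ i ])

  A : Fin n → Fin n → ℚ
  A x y = if does (x ~? y) then 1ℚ else 0ℚ

  record IsEigenvalue (θ : ℝ) : Set where
    field
      vector   : Fin n → ℝ
      nonzero  : ∃[ x ] seq (vector x) #ʳ const 0ℚ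
      equation : ∀ x → (λ t → sum (λ y → A x y ℚ.* seq (vector y) t))
                       ≈ʳ (λ t → seq θ t ℚ.* seq (vector x) t)

  record IsSmallestEigenvalue (θ : ℝ) : Set where
    field
      isEigenvalue : IsEigenvalue θ
      smallest     : ∀ μ → IsEigenvalue μ → seq θ ≤ʳ seq μ

  IsClique : Pred (Subset n) 0ℓ
  IsClique S = ∀ {x y} → x ∈ S → y ∈ S → x ≢ y → x ~ y

  IsMaximalClique : Pred (Subset n) 0ℓ
  IsMaximalClique S = IsClique S × (∀ T → IsClique T → S ⊆ T → T ⊆ S)

  -- A clique with 1 + k / (- θ) vertices, where θ is the smallest
  -- eigenvalue; ι is the reciprocal of - θ.

  record IsDelsarteClique (k : ℕ) (S : Subset n) : Set where
    field
      isClique   : IsClique S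
      θ          : ℝ
      isSmallest : IsSmallestEigenvalue θ
      ι          : ℝ
      reciprocal : (λ t → seq ι t ℚ.* (ℚ.- seq θ t)) ≈ʳ const 1ℚ
      size       : const (ℕ→ℚ ∣ S ∣) ≈ʳ (λ t → 1ℚ ℚ.+ ℕ→ℚ k ℚ.* seq ι t)

  record IsGeometric (dr : IsDistanceRegular) (𝒞 : Pred (Subset n) 0ℓ) : Set where
    field
      delsarte : ∀ ℓ → 𝒞 ℓ → IsDelsarteClique (IsDistanceRegular.valency dr) ℓ
      edge     : ∀ x y → x ~ y → ∃! _≡_ λ ℓ → 𝒞 ℓ × x ∈ ℓ × y ∈ ℓ

  DualPasch : Pred (Subset n) 0ℓ → Set
  DualPasch 𝒞 = ∀ x y ℓ → x ~ y → 𝒞 ℓ → x ∈ ℓ → y ∈ ℓ →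
    ∀ z w → (x ~ z × y ~ z × z ∉ ℓ) → (x ~ w × y ~ w × w ∉ ℓ) → z ≢ w → z ~ w

  IsAssembly : Pred (Subset n) 0ℓ → Pred (Subset n) 0ℓ
  IsAssembly 𝒞 M = IsMaximalClique M × ¬ 𝒞 M

{-# OPTIONS --safe #-}
module Submission where

-- The smallest eigenvalue of Γ is -[D]: the standard sequence of -[D]
-- alternates in sign, and a Perron–Frobenius argument shows that no eigenvalue
-- is smaller.  Hence lines have β + 1 points.  The radial eigenvector f of -[D]
-- around x satisfies Σ_ℓ (Σ_{z ∈ ℓ} f z)² = fᵀ (A + [D] I) f = 0, so f sums to
-- zero on every line; therefore a vertex off a line ℓ with a neighbour on ℓ has
-- exactly α + 1 neighbours on ℓ.
--
-- In the local graph at x, call y and z crossing if they are adjacent and not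
-- on a common line through x.  Each y crosses exactly α points of each other
-- line through x, and the dual Pasch axiom makes any two points crossing y
-- adjacent.  As there are at least three lines through x, crossing generates an
-- equivalence relation each of whose classes meets each line through x in α
-- further points, and two neighbours of x are adjacent precisely when they are
-- in the same class or on the same line.  So the assemblies through x are the
-- classes together with x, and the classes and the lines through x are the two
-- coordinates of the grid.

open import Defs
open import Algebra.Bundles using (CommutativeRing)
open import Data.Bool.Base using (if_then_else_)
open import Data.Empty using (⊥; ⊥-elim; ⊥-elim-irr)
open import Data.Fin.Base as Fin using (Fin; zero; suc)
import Data.Fin.Properties as Fin
open import Data.Fin.Subset using (Subset; _∈_; _∉_; _⊆_; _∩_; ∣_∣; Nonempty; inside; outside)
  renaming (⊥ to ∅)
open import Data.Fin.Subset.Properties using (_∈?_; ∉⊥; drop-there; ⊆-antisym; x∈p∩q⁺; x∈p∩q⁻)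
open import Data.Integer.Base as ℤ using (ℤ; 1ℤ)
import Data.Integer.Properties as ℤ
open import Data.Irrelevant using ([_])
open import Data.Nat.Base as ℕ using (ℕ; zero; suc)
import Data.Nat.Properties as ℕ
open import Data.Product using (∃!; ∃; Σ-syntax; ∃-syntax; _×_; _,_; proj₁; proj₂)
open import Data.Rational.Base as ℚ using (ℚ; 0ℚ; 1ℚ; _+_; _*_; _-_; -_; _≤_; _<_)
import Data.Rational.Properties as ℚ
import Data.Rational.Unnormalised.Base as ℚᵘ
import Data.Rational.Unnormalised.Properties as ℚᵘ
open import Data.Refinement using (Refinement-syntax; value; value-injective; _,_)
open import Data.Sum.Base using (_⊎_; inj₁; inj₂)
open import Data.Vec.Base using (_∷_; []; here; there; tabulate)
import Data.Vec.Properties as Vec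
open import Function.Base using (_∘_)
open import Function.Bundles using (_↔_; mk⇔; mk↔ₛ′; Equivalence)
open import Level using (0ℓ)
open import Relation.Binary.Definitions using (tri<; tri≈; tri>)
open import Relation.Binary.PropositionalEquality hiding (J; [_])
open import Relation.Nullary using (¬_; Dec; yes; no; does; contradiction)
open import Relation.Nullary.Decidable
  using (_×-dec_; _⊎-dec_; ¬?; map′; dec⇒maybe; dec-true; dec-false; decidable-stable; recompute)
open import Relation.Unary using (Pred; Decidable)
open import Tactic.RingSolver using (solve-∀)
open import Tactic.RingSolver.Core.AlmostCommutativeRing using (AlmostCommutativeRing; fromCommutativeRing)

open import Algebra.Properties.Group ℚ.+-0-group using (∙-cancelˡ)
open import Algebra.Properties.Semiring.Sum (CommutativeRing.semiring ℚ.+-*-commutativeRing)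
  using (sum; sum-cong-≗; ∑-distrib-+; ∑-comm; *-distribˡ-sum; *-distribʳ-sum; sum-replicate-zero)

-- The obstacle to identifying the smallest eigenvalue is that `θ`, its eigenvector and the
-- reciprocal `ι` are Cauchy sequences whose equations hold only in the limit, so the sign of an
-- entry cannot be decided. The lower bound is therefore proved for an arbitrary rational vector,
-- without assuming it to be an eigenvector, and is then applied to a single late term of the
-- sequences, the defect of the eigenvalue equation being absorbed by an explicit tolerance. What
-- comes out is a strict inequality or an equality between rationals; both are decidable, so
-- arguments by contradiction remain available. The sequence for -[D] alternates because 1 + α[i]
-- and β - α[i] are positive for i < D, the second ultimately because some vertex has a neighbour at
-- distance D from another. The numbers α, β/α and [D] enter as rationals. Their integrality is
-- never derived from divisibility: each of them is found as the cardinality of an explicit finite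
-- set.

ℚ-ring : AlmostCommutativeRing 0ℓ 0ℓ
ℚ-ring = fromCommutativeRing ℚ.+-*-commutativeRing (λ x → dec⇒maybe (0ℚ ℚ.≟ x))

-- Rational arithmetic

0≤1 : 0ℚ ≤ 1ℚ
0≤1 = ℚ.<⇒≤ (ℚ.positive⁻¹ 1ℚ)

0≤+ : ∀ {p q} → 0ℚ ≤ p → 0ℚ ≤ q → 0ℚ ≤ p + q
0≤+ {p} {q} 0≤p 0≤q = subst (_≤ p + q) (ℚ.+-identityˡ 0ℚ) (ℚ.+-mono-≤ 0≤p 0≤q)

0<+ : ∀ {p q} → 0ℚ < p → 0ℚ ≤ q → 0ℚ < p + q
0<+ {p} {q} 0<p 0≤q = subst (_< p + q) (ℚ.+-identityˡ 0ℚ) (ℚ.+-mono-<-≤ 0<p 0≤q)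

0≤* : ∀ {p q} → 0ℚ ≤ p → 0ℚ ≤ q → 0ℚ ≤ p * q
0≤* {p} {q} 0≤p 0≤q = subst (_≤ p * q) (ℚ.*-zeroʳ p)
  (ℚ.*-monoˡ-≤-nonNeg p {{ℚ.nonNegative 0≤p}} 0≤q)

0<* : ∀ {p q} → 0ℚ < p → 0ℚ < q → 0ℚ < p * q
0<* {p} {q} 0<p 0<q = subst (_< p * q) (ℚ.*-zeroʳ p)
  (ℚ.*-monoʳ-<-pos p {{ℚ.positive 0<p}} 0<q)

0<*⇒0< : ∀ {p q} → 0ℚ ≤ p → 0ℚ < p * q → 0ℚ < q
0<*⇒0< {p} {q} 0≤p 0<pq = ℚ.*-cancelˡ-<-nonNeg p {{ℚ.nonNegative 0≤p}}
  (subst (_< p * q) (sym (ℚ.*-zeroʳ p)) 0<pq)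

*-cancelˡ : ∀ {p q r} → 0ℚ < p → p * q ≡ p * r → q ≡ r
*-cancelˡ {p} 0<p eq = ℚ.≤-antisym
  (ℚ.*-cancelˡ-≤-pos p {{ℚ.positive 0<p}} (ℚ.≤-reflexive eq))
  (ℚ.*-cancelˡ-≤-pos p {{ℚ.positive 0<p}} (ℚ.≤-reflexive (sym eq)))

≤-by : ∀ {p q} d → 0ℚ ≤ d → p + d ≡ q → p ≤ q
≤-by {p} d 0≤d eq = subst₂ _≤_ (ℚ.+-identityʳ p) eq (ℚ.+-monoʳ-≤ p 0≤d)

<-by : ∀ {p q} d → 0ℚ < d → p + d ≡ q → p < q
<-by {p} d 0<d eq = subst₂ _<_ (ℚ.+-identityʳ p) eq (ℚ.+-monoʳ-< p 0<d)

p≤q⇒0≤q-p : ∀ {p q} → p ≤ q → 0ℚ ≤ q - p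
p≤q⇒0≤q-p {p} {q} p≤q = subst (_≤ q - p) (ℚ.+-inverseʳ p) (ℚ.+-monoˡ-≤ (- p) p≤q)

p<q⇒0<q-p : ∀ {p q} → p < q → 0ℚ < q - p
p<q⇒0<q-p {p} {q} p<q = subst (_< q - p) (ℚ.+-inverseʳ p) (ℚ.+-monoˡ-< (- p) p<q)

square-nonneg : ∀ p → 0ℚ ≤ p * p
square-nonneg p with ℚ.≤-total 0ℚ p
... | inj₁ 0≤p = 0≤* 0≤p 0≤p
... | inj₂ p≤0 = subst (0ℚ ≤_) (neg*neg p) (0≤* 0≤-p 0≤-p)
  where
  neg*neg : ∀ p → (0ℚ - p) * (0ℚ - p) ≡ p * p
  neg*neg = solve-∀ ℚ-ring
  0≤-p = p≤q⇒0≤q-p p≤0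

square-zero : ∀ p → p * p ≡ 0ℚ → p ≡ 0ℚ
square-zero p eq with ℚ.<-cmp p 0ℚ
... | tri≈ _ p≡0 _ = p≡0
... | tri> _ _ 0<p = contradiction (sym eq) (ℚ.<⇒≢ (0<* 0<p 0<p))
... | tri< p<0 _ _ = contradiction (sym (trans (neg*neg p) eq)) (ℚ.<⇒≢ (0<* 0<-p 0<-p))
  where
  neg*neg : ∀ p → (0ℚ - p) * (0ℚ - p) ≡ p * p
  neg*neg = solve-∀ ℚ-ring
  0<-p = p<q⇒0<q-p p<0

-- `ℤ→ℚ` normalises by a gcd, which blocks computation on a variable. Among unnormalised rationals
-- the image is a plain fraction over 1, and the homomorphism laws become integer identities.
toℚᵘ-ℤ→ℚ : ∀ i → ℚ.toℚᵘ (ℤ→ℚ i) ℚᵘ.≃ ℚᵘ.mkℚᵘ i 0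
toℚᵘ-ℤ→ℚ i = ℚ.toℚᵘ-fromℚᵘ (ℚᵘ.mkℚᵘ i 0)

ℤ→ℚ-+ : ∀ i j → ℤ→ℚ (i ℤ.+ j) ≡ ℤ→ℚ i + ℤ→ℚ j
ℤ→ℚ-+ i j = ℚ.toℚᵘ-injective (ℚᵘ.≃-trans (toℚᵘ-ℤ→ℚ (i ℤ.+ j)) (ℚᵘ.≃-trans
  (ℚᵘ.*≡* (cong (ℤ._* 1ℤ) (sym (cong₂ ℤ._+_ (ℤ.*-identityʳ i) (ℤ.*-identityʳ j)))))
  (ℚᵘ.≃-sym (ℚᵘ.≃-trans (ℚ.toℚᵘ-homo-+ (ℤ→ℚ i) (ℤ→ℚ j))
    (ℚᵘ.+-cong (toℚᵘ-ℤ→ℚ i) (toℚᵘ-ℤ→ℚ j))))))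

ℤ→ℚ-* : ∀ i j → ℤ→ℚ (i ℤ.* j) ≡ ℤ→ℚ i * ℤ→ℚ j
ℤ→ℚ-* i j = ℚ.toℚᵘ-injective (ℚᵘ.≃-trans (toℚᵘ-ℤ→ℚ (i ℤ.* j)) (ℚᵘ.≃-trans
  (ℚᵘ.*≡* refl)
  (ℚᵘ.≃-sym (ℚᵘ.≃-trans (ℚ.toℚᵘ-homo-* (ℤ→ℚ i) (ℤ→ℚ j))
    (ℚᵘ.*-cong (toℚᵘ-ℤ→ℚ i) (toℚᵘ-ℤ→ℚ j))))))

ℤ→ℚ-neg : ∀ i → ℤ→ℚ (ℤ.- i) ≡ - ℤ→ℚ i
ℤ→ℚ-neg i = ℚ.toℚᵘ-injective (ℚᵘ.≃-trans (toℚᵘ-ℤ→ℚ (ℤ.- i))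
  (ℚᵘ.≃-sym (ℚᵘ.≃-trans (ℚ.toℚᵘ-homo‿- (ℤ→ℚ i)) (ℚᵘ.-‿cong (toℚᵘ-ℤ→ℚ i)))))

ℤ→ℚ-mono-≤ : ∀ {i j} → i ℤ.≤ j → ℤ→ℚ i ≤ ℤ→ℚ j
ℤ→ℚ-mono-≤ {i} {j} i≤j = ℚ.toℚᵘ-cancel-≤ (ℚᵘ.≤-respˡ-≃ (ℚᵘ.≃-sym (toℚᵘ-ℤ→ℚ i))
  (ℚᵘ.≤-respʳ-≃ (ℚᵘ.≃-sym (toℚᵘ-ℤ→ℚ j)) (ℚᵘ.*≤* (ℤ.*-monoʳ-≤-nonNeg 1ℤ i≤j))))

ℤ→ℚ-injective : ∀ {i j} → ℤ→ℚ i ≡ ℤ→ℚ j → i ≡ j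
ℤ→ℚ-injective {i} {j} eq with
  ℚᵘ.≃-trans (ℚᵘ.≃-sym (toℚᵘ-ℤ→ℚ i)) (ℚᵘ.≃-trans (ℚᵘ.≃-reflexive (cong ℚ.toℚᵘ eq)) (toℚᵘ-ℤ→ℚ j))
... | ℚᵘ.*≡* i*1≡j*1 = trans (sym (ℤ.*-identityʳ i)) (trans i*1≡j*1 (ℤ.*-identityʳ j))

ℕ→ℚ-suc : ∀ n → ℕ→ℚ (suc n) ≡ 1ℚ + ℕ→ℚ n
ℕ→ℚ-suc n = ℤ→ℚ-+ 1ℤ (ℤ.+ n)

ℕ→ℚ-injective : ∀ {m n} → ℕ→ℚ m ≡ ℕ→ℚ n → m ≡ n
ℕ→ℚ-injective eq = ℤ.+-injective (ℤ→ℚ-injective eq)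

ℕ→ℚ-nonneg : ∀ n → 0ℚ ≤ ℕ→ℚ n
ℕ→ℚ-nonneg n = ℤ→ℚ-mono-≤ {ℤ.+ 0} {ℤ.+ n} (ℤ.+≤+ ℕ.z≤n)

-- Finite sums and indicators

sum-nonneg : ∀ {n} {f : Fin n → ℚ} → (∀ i → 0ℚ ≤ f i) → 0ℚ ≤ sum f
sum-nonneg {zero}  f≥0 = ℚ.≤-refl
sum-nonneg {suc n} f≥0 = 0≤+ (f≥0 zero) (sum-nonneg (f≥0 ∘ suc))

sum-mono-≤ : ∀ {n} {f g : Fin n → ℚ} → (∀ i → f i ≤ g i) → sum f ≤ sum g
sum-mono-≤ {zero}  f≤g = ℚ.≤-refl
sum-mono-≤ {suc n} f≤g = ℚ.+-mono-≤ (f≤g zero) (sum-mono-≤ (f≤g ∘ suc))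

term≤sum : ∀ {n} {f : Fin n → ℚ} → (∀ i → 0ℚ ≤ f i) → ∀ i → f i ≤ sum f
term≤sum {suc n} {f} f≥0 zero    = ≤-by _ (sum-nonneg (f≥0 ∘ suc)) refl
term≤sum {suc n} {f} f≥0 (suc i) = ℚ.≤-trans (term≤sum (f≥0 ∘ suc) i)
  (≤-by _ (f≥0 zero) (ℚ.+-comm _ (f zero)))

sum-zero⇒zero : ∀ {n} {f : Fin n → ℚ} → (∀ i → 0ℚ ≤ f i) → sum f ≡ 0ℚ → ∀ i → f i ≡ 0ℚ
sum-zero⇒zero f≥0 eq i = ℚ.≤-antisym (subst (_ ≤_) eq (term≤sum f≥0 i)) (f≥0 i)

sum-neg : ∀ {n} (f : Fin n → ℚ) → sum (λ i → - f i) ≡ - sum f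
sum-neg {zero}  f = refl
sum-neg {suc n} f = trans (cong (- f zero +_) (sum-neg (f ∘ suc))) (sym (ℚ.neg-distrib-+ (f zero) (sum (f ∘ suc))))

sum-distrib-- : ∀ {n} (f g : Fin n → ℚ) → sum (λ i → f i - g i) ≡ sum f - sum g
sum-distrib-- f g = trans (∑-distrib-+ f (λ i → - g i)) (cong (sum f +_) (sum-neg g))

ind : ∀ {P : Set} → Dec P → ℚ
ind d = if does d then 1ℚ else 0ℚ

ind-yes : ∀ {P : Set} (d : Dec P) → P → ind d ≡ 1ℚ
ind-yes d p rewrite dec-true d p = refl

ind-no : ∀ {P : Set} (d : Dec P) → ¬ P → ind d ≡ 0ℚ
ind-no d ¬p rewrite dec-false d ¬p = refl

ind-cong : ∀ {P Q : Set} (d : Dec P) (e : Dec Q) → (P → Q) → (Q → P) → ind d ≡ ind e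
ind-cong (yes p) e f g = sym (ind-yes e (f p))
ind-cong (no ¬p) e f g = sym (ind-no e (¬p ∘ g))

ind-× : ∀ {P Q : Set} (d : Dec P) (e : Dec Q) → ind (d ×-dec e) ≡ ind d * ind e
ind-× (yes _) (yes _) = refl
ind-× (yes _) (no _)  = refl
ind-× (no _)  e       = sym (ℚ.*-zeroˡ (ind e))

ind-¬ : ∀ {P : Set} (d : Dec P) → ind (¬? d) ≡ 1ℚ - ind d
ind-¬ (yes _) = refl
ind-¬ (no _)  = refl

ind-nonneg : ∀ {P : Set} (d : Dec P) → 0ℚ ≤ ind d
ind-nonneg (yes _) = 0≤1
ind-nonneg (no _)  = ℚ.≤-refl

ind-idem : ∀ {P : Set} (d : Dec P) → ind d * ind d ≡ ind d
ind-idem (yes _) = refl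
ind-idem (no _)  = refl

sum-δ : ∀ {n} (i : Fin n) (f : Fin n → ℚ) → sum (λ j → ind (i Fin.≟ j) * f j) ≡ f i
sum-δ {suc n} zero f = trans
  (cong₂ _+_ (ℚ.*-identityˡ (f zero))
    (trans (sum-cong-≗ (λ j → ℚ.*-zeroˡ (f (suc j)))) (sum-replicate-zero n)))
  (ℚ.+-identityʳ (f zero))
sum-δ {suc n} (suc i) f = trans (cong₂ _+_ (ℚ.*-zeroˡ (f zero)) (sum-δ i (f ∘ suc)))
  (ℚ.+-identityˡ _)

-- Cardinalities live in ℚ, so that one theory of sums serves both counting
-- and linear algebra.
# : ∀ {n} {P : Pred (Fin n) 0ℓ} → Decidable P → ℚ
# P? = sum (λ i → ind (P? i))

#-cong : ∀ {n} {P Q : Pred (Fin n) 0ℓ} (P? : Decidable P) (Q? : Decidable Q) →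
         (∀ i → P i → Q i) → (∀ i → Q i → P i) → # P? ≡ # Q?
#-cong P? Q? f g = sum-cong-≗ (λ i → ind-cong (P? i) (Q? i) (f i) (g i))

#-∈ : ∀ {n} (S : Subset n) → # (_∈? S) ≡ ℕ→ℚ ∣ S ∣
#-∈ []            = refl
#-∈ (inside ∷ S)  = trans (cong (1ℚ +_) (#-∈ S)) (sym (ℕ→ℚ-suc ∣ S ∣))
#-∈ (outside ∷ S) = trans (ℚ.+-identityˡ _) (#-∈ S)

HasSize⇒# : ∀ {n k} {P : Pred (Fin n) 0ℓ} (P? : Decidable P) → P HasSize k → # P? ≡ ℕ→ℚ k
HasSize⇒# P? (S , S⇔P , ∣S∣≡k) = trans
  (#-cong P? (_∈? S) (λ x → Equivalence.from (S⇔P x)) (λ x → Equivalence.to (S⇔P x)))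
  (trans (#-∈ S) (cong ℕ→ℚ ∣S∣≡k))

⟦_⟧ : ∀ {n} {P : Pred (Fin n) 0ℓ} → Decidable P → Subset n
⟦ P? ⟧ = tabulate (does ∘ P?)

∈⟦⟧⁺ : ∀ {n} {P : Pred (Fin n) 0ℓ} (P? : Decidable P) {x} → P x → x ∈ ⟦ P? ⟧
∈⟦⟧⁺ P? {x} p = Vec.lookup⇒[]= x _ (trans (Vec.lookup∘tabulate (does ∘ P?) x) (dec-true (P? x) p))

∈⟦⟧⁻ : ∀ {n} {P : Pred (Fin n) 0ℓ} (P? : Decidable P) {x} → x ∈ ⟦ P? ⟧ → P x
∈⟦⟧⁻ P? {x} x∈ with P? x in eq
... | yes p = p
... | no _  = contradiction
  (trans (sym (Vec.[]=⇒lookup x∈)) (trans (Vec.lookup∘tabulate (does ∘ P?) x) (cong does eq))) λ ()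

#-⟦⟧ : ∀ {n} {P : Pred (Fin n) 0ℓ} (P? : Decidable P) → # P? ≡ ℕ→ℚ ∣ ⟦ P? ⟧ ∣
#-⟦⟧ P? = trans (#-cong P? (_∈? ⟦ P? ⟧) (λ _ → ∈⟦⟧⁺ P?) (λ _ → ∈⟦⟧⁻ P?)) (#-∈ ⟦ P? ⟧)

-- Gaussian coefficients

module _ {b : ℤ} .{b≢1 : b ≢ 1ℤ} where
  private
    B = ℤ→ℚ b
    g = gaussian b b≢1
    r = ℚ.1/_ (ℤ→ℚ (b ℤ.- 1ℤ)) {{ℤ→ℚ-nonZero (b≢1 ∘ ℤ.i-j≡0⇒i≡j b 1ℤ)}}

  ℤ→ℚ-∸1 : ∀ i → ℤ→ℚ (i ℤ.- 1ℤ) ≡ ℤ→ℚ i - 1ℚ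
  ℤ→ℚ-∸1 i = trans (ℤ→ℚ-+ i (ℤ.- 1ℤ)) (cong (ℤ→ℚ i +_) (ℤ→ℚ-neg 1ℤ))

  gaussian-zero : g 0 ≡ 0ℚ
  gaussian-zero = ℚ.*-zeroˡ r

  -- Together with `gaussian-zero`, this recurrence is all that is used of the quotient:
  -- nonnegativity and growth follow from it.
  gaussian-suc : ∀ j → g (suc j) ≡ B * g j + 1ℚ
  gaussian-suc j = begin
    ℤ→ℚ (b ℤ.^ suc j ℤ.- 1ℤ) * r    ≡⟨ cong (_* r) (trans (ℤ→ℚ-∸1 (b ℤ.* b ℤ.^ j)) (cong (_- 1ℚ) (ℤ→ℚ-* b (b ℤ.^ j)))) ⟩
    (B * h - 1ℚ) * r                ≡⟨ rearrange B h r ⟩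
    B * ((h - 1ℚ) * r) + (B - 1ℚ) * r
      ≡⟨ cong₂ (λ p q → B * (p * r) + q * r) (sym (ℤ→ℚ-∸1 (b ℤ.^ j))) (sym (ℤ→ℚ-∸1 b)) ⟩
    B * g j + ℤ→ℚ (b ℤ.- 1ℤ) * r    ≡⟨ cong (B * g j +_) (ℚ.*-inverseʳ (ℤ→ℚ (b ℤ.- 1ℤ))
        {{ℤ→ℚ-nonZero (b≢1 ∘ ℤ.i-j≡0⇒i≡j b 1ℤ)}}) ⟩
    B * g j + 1ℚ                    ∎
    where
    open ≡-Reasoning
    h = ℤ→ℚ (b ℤ.^ j)
    rearrange : ∀ B h r → (B * h - 1ℚ) * r ≡ B * ((h - 1ℚ) * r) + (B - 1ℚ) * r
    rearrange = solve-∀ ℚ-ring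

-- Positive solutions, limits and signs

-- The solution for the shifted coefficients is multiplied by `X 0`, so that `Y 0 * w 0` can be put
-- in front of it without dividing by any `Y`. Beyond `D` only positivity is guaranteed.
positive-solution : ∀ D (X Y : ℕ → ℚ) → (∀ j → 0ℚ < X j) → (∀ j → j ℕ.< D → 0ℚ < Y j) →
  Σ[ w ∈ (ℕ → ℚ) ] (∀ i → 0ℚ < w i) × (∀ i → i ℕ.< D → Y i * w (suc i) ≡ X i * w i)
positive-solution zero X Y X>0 Y>0 = (λ _ → 1ℚ) , (λ _ → ℚ.positive⁻¹ 1ℚ) , λ _ ()
positive-solution (suc D) X Y X>0 Y>0
  with positive-solution D (X ∘ suc) (Y ∘ suc) (X>0 ∘ suc) (λ j j<D → Y>0 (suc j) (ℕ.s≤s j<D))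
... | w , w>0 , rec = w′ , w′>0 , rec′
  where
  w′ : ℕ → ℚ
  w′ zero    = Y 0 * w 0
  w′ (suc i) = X 0 * w i
  w′>0 : ∀ i → 0ℚ < w′ i
  w′>0 zero    = 0<* (Y>0 0 (ℕ.s≤s ℕ.z≤n)) (w>0 0)
  w′>0 (suc i) = 0<* (X>0 0) (w>0 i)
  swap : ∀ a b c → a * (b * c) ≡ b * (a * c)
  swap = solve-∀ ℚ-ring
  rec′ : ∀ i → i ℕ.< suc D → Y i * w′ (suc i) ≡ X i * w′ i
  rec′ zero    _             = swap (Y 0) (X 0) (w 0)
  rec′ (suc i) (ℕ.s≤s i<D) = trans (swap (Y (suc i)) (X 0) (w (suc i)))
    (trans (cong (X 0 *_) (rec i i<D)) (swap (X 0) (X (suc i)) (w i)))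

eventually-all : ∀ {n} {P : Fin n → ℕ → Set} → (∀ y → ∃[ N ] ∀ t → N ℕ.≤ t → P y t) →
                 ∃[ N ] ∀ t → N ℕ.≤ t → ∀ y → P y t
eventually-all {zero}  ev = 0 , λ _ _ ()
eventually-all {suc n} {P} ev with ev zero | eventually-all {P = P ∘ suc} (ev ∘ suc)
... | N , h | M , k = N ℕ.⊔ M , λ { t p zero    → h t (ℕ.≤-trans (ℕ.m≤m⊔n N M) p)
                                  ; t p (suc y) → k t (ℕ.≤-trans (ℕ.m≤n⊔m N M) p) y }

-- The witness is c / (1 + W): the 1 covers `W = 0` and leaves a slack of exactly `ε`, which makes
-- the inequality strict.
small-multiple : ∀ W {c} → 0ℚ ≤ W → 0ℚ < c → ∃[ ε ] 0ℚ < ε × ε * W < c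
small-multiple W {c} 0≤W 0<c = ε , 0<ε , <-by ε 0<ε eq
  where
  0<W+1 : 0ℚ < 1ℚ + W
  0<W+1 = 0<+ (ℚ.positive⁻¹ 1ℚ) 0≤W
  instance
    pos : ℚ.Positive (1ℚ + W)
    pos = ℚ.positive 0<W+1
    nz : ℚ.NonZero (1ℚ + W)
    nz = ℚ.pos⇒nonZero (1ℚ + W)
  r = ℚ.1/ (1ℚ + W)
  ε = c * r
  0<ε : 0ℚ < ε
  0<ε = 0<* 0<c (ℚ.positive⁻¹ r {{ℚ.1/pos⇒pos (1ℚ + W)}})
  lem : ∀ c r W → c * r * W + c * r ≡ c * ((1ℚ + W) * r)
  lem = solve-∀ ℚ-ring
  eq : ε * W + ε ≡ c
  eq = trans (lem c r W) (trans (cong (c *_) (ℚ.*-inverseʳ (1ℚ + W))) (ℚ.*-identityʳ c))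

∣∣<⇒< : ∀ {p ε} → ℚ.∣ p ∣ < ε → p < ε
∣∣<⇒< {p} h = ℚ.≤-<-trans (p≤∣p∣ p) h
  where
  p≤∣p∣ : ∀ p → p ≤ ℚ.∣ p ∣
  p≤∣p∣ p with ℚ.∣p∣≡p∨∣p∣≡-p p | ℚ.≤-total 0ℚ p
  ... | _ | inj₁ 0≤p = ℚ.≤-reflexive (sym (ℚ.0≤p⇒∣p∣≡p 0≤p))
  ... | _ | inj₂ p≤0 = ℚ.≤-trans p≤0 (ℚ.0≤∣p∣ p)

∣∣<⇒-< : ∀ {p ε} → ℚ.∣ p ∣ < ε → - p < ε
∣∣<⇒-< {p} {ε} h = ∣∣<⇒< (subst (_< ε) (sym (ℚ.∣-p∣≡∣p∣ p)) h)

IsSign : ℚ → Set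
IsSign τ = τ ≡ 1ℚ ⊎ τ ≡ - 1ℚ

-- The decision is an argument so that proofs can split on it directly. Zero gets the sign 1, so the
-- value is always 1 or -1.
sign-by : ∀ {p} → Dec (0ℚ ≤ p) → ℚ
sign-by d = if does d then 1ℚ else - 1ℚ

sign : ℚ → ℚ
sign p = sign-by (0ℚ ℚ.≤? p)

sign-isSign : ∀ p → IsSign (sign p)
sign-isSign p = by (0ℚ ℚ.≤? p)
  where
  by : (d : Dec (0ℚ ≤ p)) → IsSign (sign-by d)
  by (yes _) = inj₁ refl
  by (no _)  = inj₂ refl

*-sign : ∀ p → p * sign p ≡ ℚ.∣ p ∣
*-sign p = by (0ℚ ℚ.≤? p)
  where
  *-neg-one : ∀ p → p * - 1ℚ ≡ - p
  *-neg-one = solve-∀ ℚ-ring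
  by : (d : Dec (0ℚ ≤ p)) → p * sign-by d ≡ ℚ.∣ p ∣
  by (yes 0≤p) = trans (ℚ.*-identityʳ p) (sym (ℚ.0≤p⇒∣p∣≡p 0≤p))
  by (no 0≰p)  = trans (*-neg-one p) (trans
    (sym (ℚ.0≤p⇒∣p∣≡p (ℚ.neg-antimono-≤ (ℚ.<⇒≤ (ℚ.≰⇒> 0≰p))))) (ℚ.∣-p∣≡∣p∣ p))

-- This is |p| + pτ ≥ 0; it compares an arbitrary sign on a neighbouring sphere with the opposite of
-- the sign of `p`.
sign-dominates : ∀ p {τ} → IsSign τ → 0ℚ ≤ p * (sign p + τ)
sign-dominates p = by (0ℚ ℚ.≤? p)
  where
  double : ∀ p → - p + - p ≡ p * (- 1ℚ + - 1ℚ)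
  double = solve-∀ ℚ-ring
  by : (d : Dec (0ℚ ≤ p)) → ∀ {τ} → IsSign τ → 0ℚ ≤ p * (sign-by d + τ)
  by (yes 0≤p) (inj₁ refl) = 0≤* 0≤p (0≤+ 0≤1 0≤1)
  by (yes 0≤p) (inj₂ refl) = ℚ.≤-reflexive (sym (ℚ.*-zeroʳ p))
  by (no 0≰p)  (inj₁ refl) = ℚ.≤-reflexive (sym (ℚ.*-zeroʳ p))
  by (no 0≰p)  (inj₂ refl) = subst (0ℚ ≤_) (double p) (0≤+ 0≤-p 0≤-p)
    where 0≤-p = ℚ.neg-antimono-≤ (ℚ.<⇒≤ (ℚ.≰⇒> 0≰p))

∣∣<-intro : ∀ {p ε} → p < ε → - p < ε → ℚ.∣ p ∣ < ε
∣∣<-intro {p} {ε} p<ε -p<ε with ℚ.∣p∣≡p∨∣p∣≡-p p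
... | inj₁ eq = subst (_< ε) (sym eq) p<ε
... | inj₂ eq = subst (_< ε) (sym eq) -p<ε

≡⇒∣-∣<ε : ∀ {p q ε} → p ≡ q → 0ℚ < ε → ℚ.∣ p - q ∣ < ε
≡⇒∣-∣<ε {p} refl 0<ε = subst (_< _) (cong ℚ.∣_∣ (sym (ℚ.+-inverseʳ p))) 0<ε

≤∧≢⇒< : ∀ {p q} → p ≤ q → p ≢ q → p < q
≤∧≢⇒< {p} {q} p≤q p≢q with ℚ.<-cmp p q
... | tri< p<q _ _ = p<q
... | tri≈ _ p≡q _ = contradiction p≡q p≢q
... | tri> _ _ q<p = contradiction (ℚ.<-≤-trans q<p p≤q) (ℚ.<-irrefl refl)

constant : ℚ → ℝ
constant q = record { seq = const q ; cauchy = λ ε 0<ε → 0 , λ _ _ _ _ → ≡⇒∣-∣<ε {q} refl 0<ε }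

p-0≡p : ∀ p → p - 0ℚ ≡ p
p-0≡p = solve-∀ ℚ-ring

sign*≤ : ∀ {w s e ε} → 0ℚ ≤ w → IsSign s → ℚ.∣ e ∣ < ε → w * s * e ≤ ε * w
sign*≤ {w} {s} {e} {ε} 0≤w (inj₁ refl) h = ≤-by (w * (ε - e)) (0≤* 0≤w (p≤q⇒0≤q-p (ℚ.<⇒≤ (∣∣<⇒< {e} h)))) (lem w e ε)
  where
  lem : ∀ w e ε → w * 1ℚ * e + w * (ε - e) ≡ ε * w
  lem = solve-∀ ℚ-ring
sign*≤ {w} {s} {e} {ε} 0≤w (inj₂ refl) h = ≤-by (w * (ε - - e)) (0≤* 0≤w (p≤q⇒0≤q-p (ℚ.<⇒≤ (∣∣<⇒-< {e} h)))) (lem w e ε)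
  where
  lem : ∀ w e ε → w * (- 1ℚ) * e + w * (ε - - e) ≡ ε * w
  lem = solve-∀ ℚ-ring

1+-injective : ∀ {p q} → 1ℚ + p ≡ 1ℚ + q → p ≡ q
1+-injective {p} {q} = ∙-cancelˡ 1ℚ p q

-- Distances and radial functions

module Distances {n : ℕ} (Γ : FiniteGraph n) (dr : IsDistanceRegular Γ) where
  open FiniteGraph Γ
  open IsDistanceRegular dr

  dist : Fin n → Fin n → ℕ
  dist x y = proj₁ (bounded x y)

  dist≤diameter : ∀ x y → dist x y ℕ.≤ diameter
  dist≤diameter x y = proj₁ (proj₂ (bounded x y))

  distance : ∀ x y → Distance graph x y (dist x y)
  distance x y = proj₂ (proj₂ (bounded x y))

  dist-unique : ∀ {x y i} → Distance graph x y i → dist x y ≡ i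
  dist-unique {x} {y} {i} (p , h) =
    ℕ.≤-antisym (proj₂ (distance x y) i p) (h _ (proj₁ (distance x y)))

  Distance? : ∀ x y i → Dec (Distance graph x y i)
  Distance? x y i = map′ (λ e → subst (Distance graph x y) e (distance x y)) dist-unique
    (dist x y ℕ.≟ i)

  dist-refl : ∀ x → dist x x ≡ 0
  dist-refl x = dist-unique ([] , λ _ _ → ℕ.z≤n)

  dist≡0⇒≡ : ∀ {x y} → dist x y ≡ 0 → x ≡ y
  dist≡0⇒≡ {x} {y} eq with dist x y | proj₁ (distance x y)
  dist≡0⇒≡ refl | _ | [] = refl

  ~⇒dist≡1 : ∀ {x y} → x ~ y → dist x y ≡ 1
  ~⇒dist≡1 {x} {y} x~y = dist-unique (x~y ∷ [] , λ { zero [] → ⊥-elim (~-irrefl x~y) ; (suc _) _ → ℕ.s≤s ℕ.z≤n })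

  dist≡1⇒~ : ∀ {x y} → dist x y ≡ 1 → x ~ y
  dist≡1⇒~ {x} {y} eq with dist x y | proj₁ (distance x y)
  dist≡1⇒~ refl | _ | x~y ∷ [] = x~y

  snoc : ∀ {l x y z} → Walk graph l x y → y ~ z → Walk graph (suc l) x z
  snoc []      e = e ∷ []
  snoc (d ∷ p) e = d ∷ snoc p e

  unsnoc : ∀ {l x z} → Walk graph (suc l) x z → ∃[ y ] Walk graph l x y × y ~ z
  unsnoc (e ∷ [])          = _ , [] , e
  unsnoc (e ∷ p@(_ ∷ _)) with unsnoc p
  ... | y , q , d = y , e ∷ q , d

  dist-step-≤ : ∀ x {y z} → y ~ z → dist x z ℕ.≤ suc (dist x y)
  dist-step-≤ x {y} {z} y~z = proj₂ (distance x z) _ (snoc (proj₁ (distance x y)) y~z)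

  dist-step : ∀ x {y z} → y ~ z →
    dist x z ≡ suc (dist x y) ⊎ dist x z ≡ dist x y ⊎ suc (dist x z) ≡ dist x y
  dist-step x {y} {z} y~z with ℕ.<-cmp (dist x z) (dist x y)
  ... | tri< lt _ _ = inj₂ (inj₂ (ℕ.≤-antisym lt (dist-step-≤ x (~-sym y~z))))
  ... | tri≈ _ eq _ = inj₂ (inj₁ eq)
  ... | tri> _ _ gt = inj₁ (ℕ.≤-antisym (dist-step-≤ x y~z) gt)

  A-sym : ∀ x y → A Γ x y ≡ A Γ y x
  A-sym x y = ind-cong (x ~? y) (y ~? x) ~-sym ~-sym

  -- c 0 carries no information; 0 is the value that the formula for
  -- classical parameters gives at i = 0.
  bℚ cℚ : ℕ → ℚ
  bℚ i       = ℕ→ℚ (b i)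
  cℚ zero    = 0ℚ
  cℚ (suc i) = ℕ→ℚ (c (suc i))

  k : ℚ
  k = ℕ→ℚ valency

  forward? : ∀ x y → Decidable (λ z → y ~ z × dist x z ≡ suc (dist x y))
  forward? x y z = (y ~? z) ×-dec (dist x z ℕ.≟ suc (dist x y))

  backward? : ∀ x y → Decidable (λ z → y ~ z × suc (dist x z) ≡ dist x y)
  backward? x y z = (y ~? z) ×-dec (suc (dist x z) ℕ.≟ dist x y)

  #-forward : ∀ x y → # (forward? x y) ≡ bℚ (dist x y)
  #-forward x y = trans
    (#-cong (forward? x y) (λ z → (y ~? z) ×-dec Distance? x z (suc (dist x y)))
      (λ z (e , d) → e , subst (Distance graph x z) d (distance x z))
      (λ z (e , d) → e , dist-unique d))
    (HasSize⇒# (λ z → (y ~? z) ×-dec Distance? x z (suc (dist x y))) (b-counts (distance x y)))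

  #-backward : ∀ x y → # (backward? x y) ≡ cℚ (dist x y)
  #-backward x y with dist x y in eq
  ... | zero = trans (sum-cong-≗ (λ z → ind-no ((y ~? z) ×-dec (suc (dist x z) ℕ.≟ zero)) λ ()))
                     (sum-replicate-zero n)
  ... | suc i = trans
    (#-cong (λ z → (y ~? z) ×-dec (suc (dist x z) ℕ.≟ suc i)) (λ z → (y ~? z) ×-dec Distance? x z i)
      (λ z (e , d) → e , subst (Distance graph x z) (ℕ.suc-injective d) (distance x z))
      (λ z (e , d) → e , cong suc (dist-unique d)))
    (HasSize⇒# (λ z → (y ~? z) ×-dec Distance? x z i) (c-counts (subst (Distance graph x y) eq (distance x y))))

  #-neighbours : ∀ x → # (x ~?_) ≡ k
  #-neighbours x = trans
    (#-cong (x ~?_) (forward? x x)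
      (λ z e → e , trans (~⇒dist≡1 e) (cong suc (sym (dist-refl x)))) (λ z → proj₁))
    (trans (#-forward x x) (cong bℚ (dist-refl x)))

  -- A row of the quotient matrix of the distance partition, with a_i = k - b_i - c_i substituted.
  -- At `i = 0` the term with `ℕ.pred i` vanishes.
  radial : (ℕ → ℚ) → ℕ → ℚ
  radial φ i = k * φ i + bℚ i * (φ (suc i) - φ i) + cℚ i * (φ (ℕ.pred i) - φ i)

  -- A neighbour of `y` lies in the sphere of `y` around `x` or in an adjacent one. Each neighbour
  -- is credited with `φ i`, and only the forward and backward ones need a correction.
  A-radial : ∀ (φ : ℕ → ℚ) x y → sum (λ z → A Γ y z * φ (dist x z)) ≡ radial φ (dist x y)
  A-radial φ x y = begin
    sum (λ z → A Γ y z * φ (dist x z))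
      ≡⟨ sum-cong-≗ pointwise ⟩
    sum (λ z → ind (y ~? z) * φ i + ind (forward? x y z) * (φ (suc i) - φ i)
               + ind (backward? x y z) * (φ (ℕ.pred i) - φ i))
      ≡⟨ trans (∑-distrib-+ (λ z → ind (y ~? z) * φ i + ind (forward? x y z) * (φ (suc i) - φ i)) _)
          (cong (_+ sum (λ z → ind (backward? x y z) * (φ (ℕ.pred i) - φ i))) (∑-distrib-+ (λ z → ind (y ~? z) * φ i) _)) ⟩
    sum (λ z → ind (y ~? z) * φ i) + sum (λ z → ind (forward? x y z) * (φ (suc i) - φ i))
      + sum (λ z → ind (backward? x y z) * (φ (ℕ.pred i) - φ i))
      ≡⟨ cong₂ _+_ (cong₂ _+_ (const* (y ~?_) (#-neighbours y)) (const* (forward? x y) (#-forward x y)))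
                   (const* (backward? x y) (#-backward x y)) ⟩
    radial φ i ∎
    where
    open ≡-Reasoning
    i = dist x y
    const* : ∀ {P : Pred (Fin n) 0ℓ} (P? : Decidable P) {s t} → # P? ≡ s → sum (λ z → ind (P? z) * t) ≡ s * t
    const* P? {s} {t} eq = trans (sym (*-distribʳ-sum t (λ z → ind (P? z)))) (cong (_* t) eq)
    z₀ : ∀ p q r → 0ℚ ≡ 0ℚ * p + 0ℚ * q + 0ℚ * r
    z₀ = solve-∀ ℚ-ring
    z₁ : ∀ p q r → 1ℚ * q ≡ 1ℚ * p + 1ℚ * (q - p) + 0ℚ * r
    z₁ = solve-∀ ℚ-ring
    z₂ : ∀ p q r → 1ℚ * p ≡ 1ℚ * p + 0ℚ * q + 0ℚ * r
    z₂ = solve-∀ ℚ-ring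
    z₃ : ∀ p q r → 1ℚ * r ≡ 1ℚ * p + 0ℚ * q + 1ℚ * (r - p)
    z₃ = solve-∀ ℚ-ring
    pointwise : ∀ z → A Γ y z * φ (dist x z) ≡
      ind (y ~? z) * φ i + ind (forward? x y z) * (φ (suc i) - φ i)
               + ind (backward? x y z) * (φ (ℕ.pred i) - φ i)
    pointwise z with y ~? z in eq
    ... | no ≁ = trans (ℚ.*-zeroˡ (φ (dist x z))) (z₀ (φ i) (φ (suc i) - φ i) (φ (ℕ.pred i) - φ i))
    ... | yes y~z with dist-step x y~z
    ... | inj₁ up rewrite dec-true (dist x z ℕ.≟ suc i) up
                        | dec-false (suc (dist x z) ℕ.≟ i) (λ e → ℕ.<-irrefl (trans (sym e) (cong suc up)) (ℕ.m<n⇒m<1+n (ℕ.n<1+n i)))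
                        = trans (cong (λ j → 1ℚ * φ j) up) (z₁ (φ i) (φ (suc i)) (φ (ℕ.pred i) - φ i))
    ... | inj₂ (inj₁ lv) rewrite dec-false (dist x z ℕ.≟ suc i) (λ e → ℕ.<-irrefl (trans (sym lv) e) (ℕ.n<1+n i))
                               | dec-false (suc (dist x z) ℕ.≟ i) (λ e → ℕ.<-irrefl (trans (sym e) (cong suc lv)) (ℕ.n<1+n i))
                        = trans (cong (λ j → 1ℚ * φ j) lv) (z₂ (φ i) (φ (suc i) - φ i) (φ (ℕ.pred i) - φ i))
    ... | inj₂ (inj₂ dn) rewrite dec-false (dist x z ℕ.≟ suc i) (λ e → ℕ.<-irrefl (trans (sym dn) (cong suc e)) (ℕ.m<n⇒m<1+n (ℕ.n<1+n i)))
                               | dec-true (suc (dist x z) ℕ.≟ i) dn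
                        = trans (cong (λ j → 1ℚ * φ j) (cong ℕ.pred dn)) (z₃ (φ i) (φ (suc i) - φ i) (φ (ℕ.pred i)))

  -- Cutting the last edge off a walk that realises the diameter leaves a vertex with a neighbour
  -- one step further out.
  #-last-forward : ∀ {E} → diameter ≡ suc E → 0ℚ < bℚ E
  #-last-forward {E} eq with attained
  ... | x , y , far with unsnoc (subst (λ i → Walk graph i x y) eq (proj₁ far))
  ... | z , walk , z~y = subst (λ i → 0ℚ < bℚ i) dist≡E
    (ℚ.<-≤-trans (subst (0ℚ <_) (sym (ind-yes (forward? x z y) (z~y , trans (trans (dist-unique far) eq) (cong suc (sym dist≡E))))) (ℚ.positive⁻¹ 1ℚ))
      (ℚ.≤-trans (term≤sum (λ w → ind-nonneg (forward? x z w)) y) (ℚ.≤-reflexive (#-forward x z))))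
    where
    dist≡E : dist x z ≡ E
    dist≡E = ℕ.≤-antisym (proj₂ (distance x z) E walk)
      (ℕ.s≤s⁻¹ (subst (ℕ._≤ suc (dist x z)) (trans (dist-unique far) eq) (dist-step-≤ x z~y)))

-- The smallest eigenvalue

module Spectrum {n : ℕ} (Γ : FiniteGraph n) (dr : IsDistanceRegular Γ)
  (D : ℕ) (b : ℤ) (α β : ℚ) (classical : HasClassicalParameters Γ dr D b α β)
  (b≥2 : ℤ.+ 2 ℤ.≤ b) (α≥1 : 1ℚ ≤ α) (D≥3 : 3 ℕ.≤ D) where

  open FiniteGraph Γ
  open IsDistanceRegular dr using (diameter; attained; valency)
  open HasClassicalParameters classical
  open Distances Γ dr public

  g : ℕ → ℚ
  g = gaussian b b≢1

  B : ℚ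
  B = ℤ→ℚ b

  0≤B : 0ℚ ≤ B
  0≤B = ℚ.≤-trans (ℤ→ℚ-mono-≤ {ℤ.+ 0} {ℤ.+ 2} (ℤ.+≤+ ℕ.z≤n)) (ℤ→ℚ-mono-≤ b≥2)

  0≤B-1 : 0ℚ ≤ B - 1ℚ
  0≤B-1 = p≤q⇒0≤q-p (ℚ.≤-trans (ℤ→ℚ-mono-≤ {ℤ.+ 1} {ℤ.+ 2} (ℤ.+≤+ (ℕ.s≤s ℕ.z≤n))) (ℤ→ℚ-mono-≤ b≥2))

  0<1 : 0ℚ < 1ℚ
  0<1 = ℚ.positive⁻¹ 1ℚ

  0≤α : 0ℚ ≤ α
  0≤α = ℚ.≤-trans 0≤1 α≥1

  g-nonneg : ∀ j → 0ℚ ≤ g j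
  g-nonneg zero    = ℚ.≤-reflexive (sym (gaussian-zero {b} {b≢1}))
  g-nonneg (suc j) = subst (0ℚ ≤_) (sym (gaussian-suc {b} {b≢1} j)) (0≤+ (0≤* 0≤B (g-nonneg j)) 0≤1)

  g-one : g 1 ≡ 1ℚ
  g-one = trans (gaussian-suc {b} {b≢1} 0) (trans (cong (λ p → B * p + 1ℚ) (gaussian-zero {b} {b≢1})) (lem B))
    where
    lem : ∀ B → B * 0ℚ + 1ℚ ≡ 1ℚ
    lem = solve-∀ ℚ-ring

  g-step : ∀ j → g j + 1ℚ ≤ g (suc j)
  g-step j = ≤-by ((B - 1ℚ) * g j) (0≤* 0≤B-1 (g-nonneg j))
    (trans (lem B (g j)) (sym (gaussian-suc {b} {b≢1} j)))
    where
    lem : ∀ B g → g + 1ℚ + (B - 1ℚ) * g ≡ B * g + 1ℚ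
    lem = solve-∀ ℚ-ring

  g-mono-≤ : ∀ {i j} → i ℕ.≤ j → g i ≤ g j
  g-mono-≤ i≤j = go (ℕ.≤⇒≤′ i≤j)
    where
    go : ∀ {i j} → i ℕ.≤′ j → g i ≤ g j
    go (ℕ.≤′-reflexive refl) = ℚ.≤-refl
    go {i} (ℕ.≤′-step {j} p) = ℚ.≤-trans (go p) (ℚ.≤-trans (≤-by 1ℚ 0≤1 refl) (g-step j))

  g-mono-< : ∀ {i j} → i ℕ.< j → g i < g j
  g-mono-< {i} i<j = ℚ.<-≤-trans (<-by 1ℚ 0<1 refl) (ℚ.≤-trans (g-step i) (g-mono-≤ i<j))

  0<g[D] : 0ℚ < g D
  0<g[D] = subst (_< g D) (gaussian-zero {b} {b≢1}) (g-mono-< (ℕ.≤-trans (ℕ.s≤s ℕ.z≤n) D≥3))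

  bℚ-formula : ∀ {i} → i ℕ.≤ D → bℚ i ≡ (g D - g i) * (β - α * g i)
  bℚ-formula = b-formula _

  cℚ-formula : ∀ {i} → i ℕ.≤ D → cℚ i ≡ g i * (1ℚ + α * g (ℕ.pred i))
  cℚ-formula {zero}  _   = sym (trans (cong (_* (1ℚ + α * g 0)) (gaussian-zero {b} {b≢1})) (ℚ.*-zeroˡ (1ℚ + α * g 0)))
  cℚ-formula {suc i} i<D = c-formula i i<D

  k-formula : k ≡ g D * β
  k-formula = trans (bℚ-formula ℕ.z≤n)
    (trans (cong (λ p → (g D - p) * (β - α * p)) (gaussian-zero {b} {b≢1})) (lem (g D) α β))
    where
    lem : ∀ G α β → (G - 0ℚ) * (β - α * 0ℚ) ≡ G * β
    lem = solve-∀ ℚ-ring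

  -- Positivity of b_{D-1} = ([D] - [D-1])(β - α[D-1]) gives the case j = D - 1; for smaller j the
  -- difference is only larger, as [j] increases and α ≥ 0.
  β-αg>0 : ∀ j → j ℕ.< D → 0ℚ < β - α * g j
  β-αg>0 j j<D = go refl
    where
    lem : ∀ α β p q → β - α * p + α * (p - q) ≡ β - α * q
    lem = solve-∀ ℚ-ring
    go : ∀ {D′} → D ≡ D′ → 0ℚ < β - α * g j
    go {zero}  refl = contradiction D≥3 λ ()
    go {suc E} refl = ℚ.<-≤-trans
      (0<*⇒0< (ℚ.<⇒≤ (p<q⇒0<q-p (g-mono-< (ℕ.n<1+n E))))
              (subst (0ℚ <_) (bℚ-formula (ℕ.n≤1+n E)) (#-last-forward diameter≡D)))
      (≤-by (α * (g E - g j)) (0≤* 0≤α (p≤q⇒0≤q-p (g-mono-≤ (ℕ.s≤s⁻¹ j<D)))) (lem α β (g E) (g j)))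

  private
    solution : Σ[ w ∈ (ℕ → ℚ) ] (∀ i → 0ℚ < w i) ×
      (∀ i → i ℕ.< D → (β - α * g i) * w (suc i) ≡ (1ℚ + α * g i) * w i)
    solution = positive-solution D (λ i → 1ℚ + α * g i) (λ i → β - α * g i)
      (λ j → 0<+ 0<1 (0≤* 0≤α (g-nonneg j))) β-αg>0

  -- (-1)ⁱ w i is, up to scaling, the standard sequence of the eigenvalue
  -- - [D]: the recurrence says that a line with 1 + α [i] points at distance i
  -- from x and β - α [i] at distance i + 1 has zero sum.
  w : ℕ → ℚ
  w = proj₁ solution

  w>0 : ∀ i → 0ℚ < w i
  w>0 = proj₁ (proj₂ solution)

  w-rec : ∀ i → i ℕ.< D → (β - α * g i) * w (suc i) ≡ (1ℚ + α * g i) * w i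
  w-rec = proj₂ (proj₂ solution)

  b-w : ∀ {i} → i ℕ.≤ D → bℚ i * w (suc i) ≡ (g D - g i) * ((1ℚ + α * g i) * w i)
  b-w {i} i≤D with ℕ.m≤n⇒m<n∨m≡n i≤D
  ... | inj₁ i<D = trans (cong (_* w (suc i)) (bℚ-formula i≤D))
    (trans (ℚ.*-assoc (g D - g i) (β - α * g i) (w (suc i))) (cong ((g D - g i) *_) (w-rec i i<D)))
  ... | inj₂ refl = trans (cong (_* w (suc i)) (bℚ-formula i≤D)) (lem (g i) (β - α * g i) (w (suc i)) ((1ℚ + α * g i) * w i))
    where
    lem : ∀ G p q r → (G - G) * p * q ≡ (G - G) * r
    lem = solve-∀ ℚ-ring

  c-w : ∀ {i} → i ℕ.≤ D → cℚ i * w (ℕ.pred i) ≡ g i * ((β - α * g (ℕ.pred i)) * w i)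
  c-w {zero} i≤D = trans (ℚ.*-zeroˡ (w 0))
    (sym (trans (cong (_* X) (gaussian-zero {b} {b≢1})) (ℚ.*-zeroˡ X)))
    where X = (β - α * g 0) * w 0
  c-w {suc i} i≤D = trans (cong (_* w i) (cℚ-formula i≤D))
    (trans (ℚ.*-assoc (g (suc i)) (1ℚ + α * g i) (w i)) (cong (g (suc i) *_) (sym (w-rec i i≤D))))

  -- Rests on a_i + [D] = ([D] - [i])(1 + α[i]) + [i](β - α[i-1]) with a_i = k - b_i - c_i; the
  -- recurrence for `w` turns each product into the term of one adjacent sphere.
  w-eigen : ∀ {i} → i ℕ.≤ D →
    (k - bℚ i - cℚ i + g D) * w i ≡ bℚ i * w (suc i) + cℚ i * w (ℕ.pred i)
  w-eigen {i} i≤D = begin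
    (k - bℚ i - cℚ i + g D) * w i
      ≡⟨ cong (λ p → (p + g D) * w i) (cong₂ _-_ (cong₂ _-_ k-formula (bℚ-formula i≤D)) (cℚ-formula i≤D)) ⟩
    (g D * β - (g D - g i) * (β - α * g i) - g i * (1ℚ + α * g (ℕ.pred i)) + g D) * w i
      ≡⟨ lem (g D) (g i) (g (ℕ.pred i)) α β (w i) ⟩
    (g D - g i) * ((1ℚ + α * g i) * w i) + g i * ((β - α * g (ℕ.pred i)) * w i)
      ≡⟨ sym (cong₂ _+_ (b-w i≤D) (c-w i≤D)) ⟩
    bℚ i * w (suc i) + cℚ i * w (ℕ.pred i) ∎
    where
    open ≡-Reasoning
    lem : ∀ G g g′ α β w → (G * β - (G - g) * (β - α * g) - g * (1ℚ + α * g′) + G) * w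
      ≡ (G - g) * ((1ℚ + α * g) * w) + g * ((β - α * g′) * w)
    lem = solve-∀ ℚ-ring

  alt : ℕ → ℚ
  alt zero    = 1ℚ
  alt (suc i) = - alt i

  v : ℕ → ℚ
  v i = alt i * w i

  c-v : ∀ i → cℚ i * v (ℕ.pred i) ≡ - alt i * (cℚ i * w (ℕ.pred i))
  c-v zero    = lem (w 0)
    where
    lem : ∀ w → 0ℚ * (1ℚ * w) ≡ - 1ℚ * (0ℚ * w)
    lem = solve-∀ ℚ-ring
  c-v (suc i) = lem (cℚ (suc i)) (alt i) (w i)
    where
    lem : ∀ c a w → c * (a * w) ≡ - - a * (c * w)
    lem = solve-∀ ℚ-ring

  radial-v : ∀ {i} → i ℕ.≤ D → radial v i ≡ - g D * v i
  radial-v {i} i≤D = begin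
    k * (s * w₀) + p * (- s * w₊ - s * w₀) + q * (v (ℕ.pred i) - s * w₀)
      ≡⟨ lem₁ k p q s w₀ w₊ (v (ℕ.pred i)) ⟩
    (k - p - q) * (s * w₀) - s * (p * w₊) + q * v (ℕ.pred i)
      ≡⟨ cong ((k - p - q) * (s * w₀) - s * (p * w₊) +_) (c-v i) ⟩
    (k - p - q) * (s * w₀) - s * (p * w₊) + - s * (q * w₋)
      ≡⟨ lem₂ (k - p - q) s w₀ (p * w₊) (q * w₋) (g D) ⟩
    s * ((k - p - q + g D) * w₀ - (p * w₊ + q * w₋)) + - g D * (s * w₀)
      ≡⟨ cong (λ t → s * (t - (p * w₊ + q * w₋)) + - g D * (s * w₀)) (w-eigen i≤D) ⟩
    s * ((p * w₊ + q * w₋) - (p * w₊ + q * w₋)) + - g D * (s * w₀)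
      ≡⟨ lem₃ s (p * w₊ + q * w₋) (- g D * (s * w₀)) ⟩
    - g D * (s * w₀) ∎
    where
    open ≡-Reasoning
    s = alt i
    p = bℚ i
    q = cℚ i
    w₀ = w i
    w₊ = w (suc i)
    w₋ = w (ℕ.pred i)
    lem₁ : ∀ k p q s w₀ w₊ t → k * (s * w₀) + p * (- s * w₊ - s * w₀) + q * (t - s * w₀)
      ≡ (k - p - q) * (s * w₀) - s * (p * w₊) + q * t
    lem₁ = solve-∀ ℚ-ring
    lem₂ : ∀ a s w₀ P Q G → a * (s * w₀) - s * P + - s * Q
      ≡ s * ((a + G) * w₀ - (P + Q)) + - G * (s * w₀)
    lem₂ = solve-∀ ℚ-ring
    lem₃ : ∀ s P Q → s * (P - P) + Q ≡ Q
    lem₃ = solve-∀ ℚ-ring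

  dist≤D : ∀ x y → dist x y ℕ.≤ D
  dist≤D x y = subst (dist x y ℕ.≤_) diameter≡D (dist≤diameter x y)

  A-v : ∀ x y → sum (λ z → A Γ y z * v (dist x z)) ≡ - g D * v (dist x y)
  A-v x y = trans (A-radial v x y) (radial-v (dist≤D x y))

  -- A Perron–Frobenius argument: alternating signs turn w into a positive
  -- eigenvector of the quotient matrix, so pairing f with w times the signs of
  -- the sums of f over the spheres around x bounds its eigenvalue below.
  module SignTest (f : Fin n → ℚ) (x : Fin n) where

    F : ℕ → ℚ
    F i = sum (λ z → ind (dist x z ℕ.≟ i) * f z)

    φ : ℕ → ℚ
    φ i = w i * sign (F i)

    sum-by-spheres : ∀ (ψ : ℕ → ℚ) → sum (λ z → f z * ψ (dist x z)) ≡ sum (λ (i : Fin (suc D)) → F (Fin.toℕ i) * ψ (Fin.toℕ i))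
    sum-by-spheres ψ = sym (begin
      sum (λ (i : Fin (suc D)) → F (Fin.toℕ i) * ψ (Fin.toℕ i))
        ≡⟨ sum-cong-≗ {n = suc D} (λ i → *-distribʳ-sum (ψ (Fin.toℕ i)) (λ z → ind (dist x z ℕ.≟ Fin.toℕ i) * f z)) ⟩
      sum (λ (i : Fin (suc D)) → sum (λ z → ind (dist x z ℕ.≟ Fin.toℕ i) * f z * ψ (Fin.toℕ i)))
        ≡⟨ ∑-comm (λ (i : Fin (suc D)) z → ind (dist x z ℕ.≟ Fin.toℕ i) * f z * ψ (Fin.toℕ i)) ⟩
      sum (λ z → sum (λ (i : Fin (suc D)) → ind (dist x z ℕ.≟ Fin.toℕ i) * f z * ψ (Fin.toℕ i)))
        ≡⟨ sum-cong-≗ inner ⟩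
      sum (λ z → f z * ψ (dist x z)) ∎)
      where
      open ≡-Reasoning
      inner : ∀ z → sum (λ (i : Fin (suc D)) → ind (dist x z ℕ.≟ Fin.toℕ i) * f z * ψ (Fin.toℕ i)) ≡ f z * ψ (dist x z)
      inner z = begin
        sum (λ (i : Fin (suc D)) → ind (dist x z ℕ.≟ Fin.toℕ i) * f z * ψ (Fin.toℕ i))
          ≡⟨ sum-cong-≗ {n = suc D} (λ i → trans (ℚ.*-assoc (ind (dist x z ℕ.≟ Fin.toℕ i)) (f z) (ψ (Fin.toℕ i)))
               (cong (_* (f z * ψ (Fin.toℕ i))) (ind-cong (dist x z ℕ.≟ Fin.toℕ i) (d Fin.≟ i)
                 (λ e → Fin.toℕ-injective (trans d≡ e)) (λ e → trans (sym d≡) (cong Fin.toℕ e))))) ⟩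
        sum (λ (i : Fin (suc D)) → ind (d Fin.≟ i) * (f z * ψ (Fin.toℕ i)))
          ≡⟨ sum-δ d (λ i → f z * ψ (Fin.toℕ i)) ⟩
        f z * ψ (Fin.toℕ d)
          ≡⟨ cong (λ j → f z * ψ j) d≡ ⟩
        f z * ψ (dist x z) ∎
        where
        d : Fin (suc D)
        d = Fin.fromℕ< (ℕ.s≤s (dist≤D x z))
        d≡ : Fin.toℕ d ≡ dist x z
        d≡ = Fin.toℕ-fromℕ< (ℕ.s≤s (dist≤D x z))

    F-zero : F 0 ≡ f x
    F-zero = trans (sum-cong-≗ (λ z → cong (_* f z) (ind-cong (dist x z ℕ.≟ 0) (x Fin.≟ z) dist≡0⇒≡
      (λ { refl → dist-refl x })))) (sum-δ x f)

    F*φ : ∀ i → F i * φ i ≡ w i * ℚ.∣ F i ∣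
    F*φ i = trans (lem (F i) (w i) (sign (F i))) (cong (w i *_) (*-sign (F i)))
      where
      lem : ∀ f w s → f * (w * s) ≡ w * (f * s)
      lem = solve-∀ ℚ-ring

    -- The signs make every sphere contribute nonnegatively, and the sphere of radius 0 is `x`
    -- alone.
    pairing-bound : w 0 * ℚ.∣ f x ∣ ≤ sum (λ z → f z * φ (dist x z))
    pairing-bound = subst₂ _≤_ (trans (F*φ 0) (cong (λ p → w 0 * ℚ.∣ p ∣) F-zero)) (sym (sum-by-spheres φ))
      (term≤sum {f = λ (i : Fin (suc D)) → F (Fin.toℕ i) * φ (Fin.toℕ i)}
        (λ i → subst (0ℚ ≤_) (sym (F*φ (Fin.toℕ i))) (0≤* (ℚ.<⇒≤ (w>0 (Fin.toℕ i))) (ℚ.0≤∣p∣ _))) zero)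

    pairing-A : sum (λ y → φ (dist x y) * sum (λ z → A Γ y z * f z)) ≡ sum (λ z → f z * radial φ (dist x z))
    pairing-A = begin
      sum (λ y → φ (dist x y) * sum (λ z → A Γ y z * f z))
        ≡⟨ sum-cong-≗ (λ y → *-distribˡ-sum (φ (dist x y)) (λ z → A Γ y z * f z)) ⟩
      sum (λ y → sum (λ z → φ (dist x y) * (A Γ y z * f z)))
        ≡⟨ ∑-comm (λ y z → φ (dist x y) * (A Γ y z * f z)) ⟩
      sum (λ z → sum (λ y → φ (dist x y) * (A Γ y z * f z)))
        ≡⟨ sum-cong-≗ (λ z → trans (sum-cong-≗ (λ y → trans (cong (λ a → φ (dist x y) * (a * f z)) (A-sym y z))
             (lem (φ (dist x y)) (A Γ z y) (f z)))) (sym (*-distribˡ-sum (f z) (λ y → A Γ z y * φ (dist x y))))) ⟩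
      sum (λ z → f z * sum (λ y → A Γ z y * φ (dist x y)))
        ≡⟨ sum-cong-≗ (λ z → cong (f z *_) (A-radial φ x z)) ⟩
      sum (λ z → f z * radial φ (dist x z)) ∎
      where
      open ≡-Reasoning
      lem : ∀ p a f → p * (a * f) ≡ f * (a * p)
      lem = solve-∀ ℚ-ring

    -- If both adjacent spheres had the sign opposite to that of `F i`, `w-eigen` would give
    -- equality; any other signs can only increase the right-hand side, by `gap`.
    radial-bound : ∀ {i} → i ℕ.≤ D → F i * (- g D * φ i) ≤ F i * radial φ i
    radial-bound {i} i≤D = ≤-by gap 0≤gap (begin
      F i * (- g D * φ i) + gap ≡⟨ lem₁ (F i) s s₊ s₋ w₀ P Q (g D) ⟩
      F i * (- g D * (w₀ * s)) + F i * (s * (P + Q)) + F i * (s₊ * P + s₋ * Q)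
        ≡⟨ cong (λ t → F i * (- g D * (w₀ * s)) + F i * (s * t) + F i * (s₊ * P + s₋ * Q)) (sym (w-eigen i≤D)) ⟩
      F i * (- g D * (w₀ * s)) + F i * (s * ((k - p - q + g D) * w₀)) + F i * (s₊ * P + s₋ * Q)
        ≡⟨ lem₂ (F i) s s₊ s₋ w₀ w₊ w₋ p q k (g D) ⟩
      F i * radial φ i ∎)
      where
      open ≡-Reasoning
      p = bℚ i
      q = cℚ i
      s = sign (F i)
      s₊ = sign (F (suc i))
      s₋ = sign (F (ℕ.pred i))
      w₀ = w i
      w₊ = w (suc i)
      w₋ = w (ℕ.pred i)
      P = p * w₊
      Q = q * w₋
      gap = P * (F i * (s + s₊)) + Q * (F i * (s + s₋))
      0≤c : ∀ i → 0ℚ ≤ cℚ i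
      0≤c zero    = ℚ.≤-refl
      0≤c (suc i) = ℕ→ℚ-nonneg (IsDistanceRegular.c dr (suc i))
      0≤gap : 0ℚ ≤ gap
      0≤gap = 0≤+ (0≤* (0≤* (ℕ→ℚ-nonneg (IsDistanceRegular.b dr i)) (ℚ.<⇒≤ (w>0 (suc i)))) (sign-dominates (F i) (sign-isSign (F (suc i)))))
                  (0≤* (0≤* (0≤c i) (ℚ.<⇒≤ (w>0 (ℕ.pred i)))) (sign-dominates (F i) (sign-isSign (F (ℕ.pred i)))))
      lem₁ : ∀ F s s₊ s₋ w₀ P Q G → F * (- G * (w₀ * s)) + (P * (F * (s + s₊)) + Q * (F * (s + s₋)))
        ≡ F * (- G * (w₀ * s)) + F * (s * (P + Q)) + F * (s₊ * P + s₋ * Q)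
      lem₁ = solve-∀ ℚ-ring
      lem₂ : ∀ F s s₊ s₋ w₀ w₊ w₋ p q k G →
        F * (- G * (w₀ * s)) + F * (s * ((k - p - q + G) * w₀)) + F * (s₊ * (p * w₊) + s₋ * (q * w₋))
        ≡ F * (k * (w₀ * s) + p * (w₊ * s₊ - w₀ * s) + q * (w₋ * s₋ - w₀ * s))
      lem₂ = solve-∀ ℚ-ring

    spectral-bound : - g D * sum (λ z → f z * φ (dist x z))
      ≤ sum (λ y → φ (dist x y) * sum (λ z → A Γ y z * f z))
    spectral-bound = subst₂ _≤_
      (trans (sym (sum-by-spheres (λ i → - g D * φ i)))
        (trans (sum-cong-≗ (λ z → lem (f z) (- g D) (φ (dist x z)))) (sym (*-distribˡ-sum (- g D) (λ z → f z * φ (dist x z))))))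
      (sym (trans pairing-A (sum-by-spheres (radial φ))))
      (sum-mono-≤ (λ (i : Fin (suc D)) → radial-bound (ℕ.s≤s⁻¹ (Fin.toℕ<n i))))
      where
      lem : ∀ f G p → f * (G * p) ≡ G * (f * p)
      lem = solve-∀ ℚ-ring

  -- The value of the smallest eigenvalue and the size of a line

  -g[D]-isEigenvalue : IsEigenvalue Γ (constant (- g D))
  -g[D]-isEigenvalue = record
    { vector   = λ y → constant (v (dist x y))
    ; nonzero  = x , w 0 , w>0 0 , 0 , λ _ _ → subst (λ p → w 0 ≤ ℚ.∣ p ∣) (sym at-x)
                   (ℚ.≤-reflexive (sym (ℚ.0≤p⇒∣p∣≡p (ℚ.<⇒≤ (w>0 0)))))
    ; equation = λ y ε 0<ε → 0 , λ _ _ → ≡⇒∣-∣<ε (A-v x y) 0<ε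
    }
    where
    x = proj₁ attained
    at-x : v (dist x x) - 0ℚ ≡ w 0
    at-x = trans (p-0≡p (v (dist x x))) (trans (cong v (dist-refl x)) (ℚ.*-identityˡ (w 0)))

  module EigenvalueBound (θ : ℝ) (isEigenvalue : IsEigenvalue Γ θ) (η : ℚ) (0<η : 0ℚ < η) where
    open IsEigenvalue isEigenvalue

    x = proj₁ nonzero
    ε₀ = proj₁ (proj₂ nonzero)
    0<ε₀ = proj₁ (proj₂ (proj₂ nonzero))
    N₀ = proj₁ (proj₂ (proj₂ (proj₂ nonzero)))
    large = proj₂ (proj₂ (proj₂ (proj₂ nonzero)))

    W : ℚ
    W = sum (λ y → w (dist x y))

    -- `ε * W` will bound the total error, and `w 0 * ε₀` bounds the pairing `H` from below, so the
    -- error stays below `η * H`.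
    tolerance : ∃[ ε ] 0ℚ < ε × ε * W < η * (w 0 * ε₀)
    tolerance = small-multiple W (sum-nonneg (λ y → ℚ.<⇒≤ (w>0 (dist x y)))) (0<* 0<η (0<* (w>0 0) 0<ε₀))

    ε : ℚ
    ε = proj₁ tolerance

    f : ℕ → Fin n → ℚ
    f t y = seq (vector y) t

    Af : ℕ → Fin n → ℚ
    Af t y = sum (λ z → A Γ y z * f t z)

    e : ℕ → Fin n → ℚ
    e t y = Af t y - seq θ t * f t y

    eventually-close : ∃[ N ] ∀ t → N ℕ.≤ t → ∀ y → ℚ.∣ e t y ∣ < ε
    eventually-close = eventually-all {P = λ y t → ℚ.∣ e t y ∣ < ε} (λ y → equation y ε (proj₁ (proj₂ tolerance)))

    module At (t : ℕ) (far : ε₀ ≤ ℚ.∣ f t x - 0ℚ ∣) (close : ∀ y → ℚ.∣ e t y ∣ < ε) where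
      open SignTest (f t) x

      τ : ℚ
      τ = seq θ t

      H : ℚ
      H = sum (λ z → f t z * φ (dist x z))

      w₀ε₀≤H : w 0 * ε₀ ≤ H
      w₀ε₀≤H = ℚ.≤-trans (ℚ.*-monoˡ-≤-nonNeg (w 0) {{ℚ.nonNegative (ℚ.<⇒≤ (w>0 0))}}
        (subst (λ p → ε₀ ≤ ℚ.∣ p ∣) (p-0≡p (f t x)) far)) pairing-bound

      0≤H : 0ℚ ≤ H
      0≤H = ℚ.≤-trans (ℚ.<⇒≤ (0<* (w>0 0) 0<ε₀)) w₀ε₀≤H

      error : ℚ
      error = sum (λ y → φ (dist x y) * e t y)

      error≤ : error ≤ ε * W
      error≤ = ℚ.≤-trans
        (sum-mono-≤ (λ y → sign*≤ {e = e t y} (ℚ.<⇒≤ (w>0 (dist x y))) (sign-isSign (F (dist x y))) (close y)))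
        (ℚ.≤-reflexive (sym (*-distribˡ-sum ε (λ y → w (dist x y)))))

      split : sum (λ y → φ (dist x y) * Af t y) ≡ τ * H + error
      split = trans (sum-cong-≗ (λ y → lem (φ (dist x y)) (Af t y) τ (f t y)))
        (trans (∑-distrib-+ (λ y → τ * (f t y * φ (dist x y))) (λ y → φ (dist x y) * e t y))
          (cong (_+ error) (sym (*-distribˡ-sum τ (λ y → f t y * φ (dist x y))))))
        where
        lem : ∀ p a τ f → p * a ≡ τ * (f * p) + p * (a - τ * f)
        lem = solve-∀ ℚ-ring

      -- Were `τ` at least `η` below -[D], `spectral-bound` would force the error up to `η * H`,
      -- which the tolerance forbids.
      bound : - g D < τ + η
      bound = decidable-stable (- g D ℚ.<? τ + η) λ ≮ → ℚ.<-irrefl refl (begin-strict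
        η * (w 0 * ε₀)          ≤⟨ ℚ.*-monoˡ-≤-nonNeg η {{ℚ.nonNegative (ℚ.<⇒≤ 0<η)}} w₀ε₀≤H ⟩
        η * H                   ≤⟨ ≤-by ((- g D - (τ + η)) * H) (0≤* (p≤q⇒0≤q-p (ℚ.≮⇒≥ ≮)) 0≤H) (lem₁ η H (g D) τ) ⟩
        - g D * H - τ * H       ≤⟨ ℚ.+-monoˡ-≤ (- (τ * H)) spectral-bound ⟩
        sum (λ y → φ (dist x y) * Af t y) - τ * H ≡⟨ cong (_- τ * H) split ⟩
        τ * H + error - τ * H   ≡⟨ lem₂ (τ * H) error ⟩
        error                   ≤⟨ error≤ ⟩
        ε * W                   <⟨ proj₂ (proj₂ tolerance) ⟩
        η * (w 0 * ε₀)          ∎)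
        where
        open ℚ.≤-Reasoning
        lem₁ : ∀ η H G τ → η * H + (- G - (τ + η)) * H ≡ - G * H - τ * H
        lem₁ = solve-∀ ℚ-ring
        lem₂ : ∀ p q → p + q - p ≡ q
        lem₂ = solve-∀ ℚ-ring

  eigenvalue-bound : ∀ θ → IsEigenvalue Γ θ → const (- g D) ≤ʳ seq θ
  eigenvalue-bound θ isEigenvalue η 0<η =
    N₀ ℕ.⊔ N , λ t N≤t → At.bound t (large t (ℕ.≤-trans (ℕ.m≤m⊔n N₀ N) N≤t))
      (proj₂ eventually-close t (ℕ.≤-trans (ℕ.m≤n⊔m N₀ N) N≤t))
    where
    open EigenvalueBound θ isEigenvalue η 0<η
    N = proj₁ eventually-close

  -- Minimality, tested against the rational eigenvalue -[D], bounds `θ` from above; being an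
  -- eigenvalue bounds it from below.
  smallest-eigenvalue : ∀ θ → IsSmallestEigenvalue Γ θ → ∀ ε → 0ℚ < ε →
    ∃[ N ] ∀ t → N ℕ.≤ t → ℚ.∣ g D - - seq θ t ∣ < ε
  smallest-eigenvalue θ isSmallest ε 0<ε = N ℕ.⊔ M , λ t N≤t → ∣∣<-intro
    (subst₂ _<_ (lem₁ (g D) (seq θ t)) (lem₂ (g D) ε) (ℚ.+-monoˡ-< (g D) (proj₂ above t (ℕ.≤-trans (ℕ.m≤m⊔n N M) N≤t))))
    (subst₂ _<_ (lem₃ (g D) (seq θ t)) (lem₄ (seq θ t) ε) (ℚ.+-monoˡ-< (- seq θ t) (proj₂ below t (ℕ.≤-trans (ℕ.m≤n⊔m N M) N≤t))))
    where
    above : ∃[ N ] ∀ t → N ℕ.≤ t → seq θ t < - g D + ε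
    above = IsSmallestEigenvalue.smallest isSmallest (constant (- g D)) -g[D]-isEigenvalue ε 0<ε
    below : ∃[ N ] ∀ t → N ℕ.≤ t → - g D < seq θ t + ε
    below = eigenvalue-bound θ (IsSmallestEigenvalue.isEigenvalue isSmallest) ε 0<ε
    N = proj₁ above
    M = proj₁ below
    lem₁ : ∀ G τ → τ + G ≡ G - - τ
    lem₁ = solve-∀ ℚ-ring
    lem₂ : ∀ G ε → (- G + ε) + G ≡ ε
    lem₂ = solve-∀ ℚ-ring
    lem₃ : ∀ G τ → - G + - τ ≡ - (G - - τ)
    lem₃ = solve-∀ ℚ-ring
    lem₄ : ∀ τ ε → (τ + ε) + - τ ≡ ε
    lem₄ = solve-∀ ℚ-ring

  -- The point is that `L * g D` equals `k`. Equality of rationals is decidable, so it may be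
  -- assumed to fail; one sufficiently late index then gives a contradiction.
  delsarte-size : ∀ {S} → IsDelsarteClique Γ valency S → ℕ→ℚ ∣ S ∣ ≡ 1ℚ + β
  delsarte-size {S} delsarte = *-cancelˡ 0<g[D] (trans (lem₀ (g D) s) (trans
    (cong (_+ g D) (decidable-stable (L * g D ℚ.≟ k) absurd)) (trans (cong (_+ g D) k-formula) (lem₁ (g D) β))))
    where
    open IsDelsarteClique delsarte
    s = ℕ→ℚ ∣ S ∣
    L = s - 1ℚ
    lem₀ : ∀ G s → G * s ≡ (s - 1ℚ) * G + G
    lem₀ = solve-∀ ℚ-ring
    lem₁ : ∀ G β → G * β + G ≡ G * (1ℚ + β)
    lem₁ = solve-∀ ℚ-ring
    -- The summands bound the coefficients of the three errors in the decomposition `lem₂` of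
    -- `L * g D - k`.
    K = ℚ.∣ L ∣ + (g D + 1ℚ) + ℚ.∣ k ∣
    0≤K : 0ℚ ≤ K
    0≤K = 0≤+ (0≤+ (ℚ.0≤∣p∣ L) (0≤+ (ℚ.<⇒≤ 0<g[D]) 0≤1)) (ℚ.0≤∣p∣ k)
    absurd : ¬ (L * g D ≢ k)
    absurd Lg≢k = ℚ.<-irrefl refl (begin-strict
      ℚ.∣ L * g D - k ∣ ≡⟨ cong ℚ.∣_∣ (lem₂ s (g D) k τ i) ⟩
      ℚ.∣ L * (g D - τ) + (s - (1ℚ + k * i)) * τ + k * (i * τ - 1ℚ) ∣
        ≤⟨ ℚ.≤-trans (ℚ.∣p+q∣≤∣p∣+∣q∣ (L * (g D - τ) + (s - (1ℚ + k * i)) * τ) (k * (i * τ - 1ℚ)))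
             (ℚ.+-monoˡ-≤ ℚ.∣ k * (i * τ - 1ℚ) ∣ (ℚ.∣p+q∣≤∣p∣+∣q∣ (L * (g D - τ)) ((s - (1ℚ + k * i)) * τ))) ⟩
      ℚ.∣ L * (g D - τ) ∣ + ℚ.∣ (s - (1ℚ + k * i)) * τ ∣ + ℚ.∣ k * (i * τ - 1ℚ) ∣
        ≤⟨ ℚ.+-mono-≤ (ℚ.+-mono-≤ (abs* L (g D - τ) (ℚ.<⇒≤ near₁)) step₂) (abs* k (i * τ - 1ℚ) (ℚ.<⇒≤ near₃)) ⟩
      ℚ.∣ L ∣ * ε + (g D + 1ℚ) * ε + ℚ.∣ k ∣ * ε ≡⟨ lem₃ ℚ.∣ L ∣ (g D + 1ℚ) ℚ.∣ k ∣ ε ⟩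
      ε * K <⟨ εK< ⟩
      ℚ.∣ L * g D - k ∣ ∎)
      where
      0<∣δ∣ : 0ℚ < ℚ.∣ L * g D - k ∣
      0<∣δ∣ = ≤∧≢⇒< (ℚ.0≤∣p∣ _) λ eq → Lg≢k (p-q≡0⇒p≡q (ℚ.∣p∣≡0⇒p≡0 _ (sym eq)))
        where
        lem : ∀ p q → p ≡ (p - q) + q
        lem = solve-∀ ℚ-ring
        p-q≡0⇒p≡q : ∀ {p q} → p - q ≡ 0ℚ → p ≡ q
        p-q≡0⇒p≡q {p} {q} eq = trans (lem p q) (trans (cong (_+ q) eq) (ℚ.+-identityˡ q))
      open ℚ.≤-Reasoning
      choice = small-multiple K 0≤K 0<∣δ∣
      ε = proj₁ choice
      0<ε : 0ℚ < ε
      0<ε = proj₁ (proj₂ choice)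
      εK< : ε * K < ℚ.∣ L * g D - k ∣
      εK< = proj₂ (proj₂ choice)
      ev₁ = smallest-eigenvalue θ isSmallest ε 0<ε
      -- The crude tolerance 1 serves only to bound |τ| by [D] + 1.
      ev₂ = smallest-eigenvalue θ isSmallest 1ℚ 0<1
      ev₃ = reciprocal ε 0<ε
      ev₄ = size ε 0<ε
      N₁ = proj₁ ev₁
      N₂ = proj₁ ev₂
      N₃ = proj₁ ev₃
      N₄ = proj₁ ev₄
      t = (N₁ ℕ.⊔ N₂) ℕ.⊔ (N₃ ℕ.⊔ N₄)
      τ = - seq θ t
      i = seq ι t
      near₁ : ℚ.∣ g D - τ ∣ < ε
      near₁ = proj₂ ev₁ t (ℕ.≤-trans (ℕ.m≤m⊔n N₁ N₂) (ℕ.m≤m⊔n (N₁ ℕ.⊔ N₂) (N₃ ℕ.⊔ N₄)))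
      near₂ : ℚ.∣ g D - τ ∣ < 1ℚ
      near₂ = proj₂ ev₂ t (ℕ.≤-trans (ℕ.m≤n⊔m N₁ N₂) (ℕ.m≤m⊔n (N₁ ℕ.⊔ N₂) (N₃ ℕ.⊔ N₄)))
      near₃ : ℚ.∣ i * τ - 1ℚ ∣ < ε
      near₃ = proj₂ ev₃ t (ℕ.≤-trans (ℕ.m≤m⊔n N₃ N₄) (ℕ.m≤n⊔m (N₁ ℕ.⊔ N₂) (N₃ ℕ.⊔ N₄)))
      near₄ : ℚ.∣ s - (1ℚ + k * i) ∣ < ε
      near₄ = proj₂ ev₄ t (ℕ.≤-trans (ℕ.m≤n⊔m N₃ N₄) (ℕ.m≤n⊔m (N₁ ℕ.⊔ N₂) (N₃ ℕ.⊔ N₄)))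
      abs* : ∀ p q {r} → ℚ.∣ q ∣ ≤ r → ℚ.∣ p * q ∣ ≤ ℚ.∣ p ∣ * r
      abs* p q h = ℚ.≤-trans (ℚ.≤-reflexive (ℚ.∣p*q∣≡∣p∣*∣q∣ p q))
        (ℚ.*-monoˡ-≤-nonNeg ℚ.∣ p ∣ {{ℚ.∣-∣-nonNeg p}} h)
      ∣τ∣≤ : ℚ.∣ τ ∣ ≤ g D + 1ℚ
      ∣τ∣≤ = ℚ.≤-trans (ℚ.≤-reflexive (cong ℚ.∣_∣ (lem₄ (g D) τ)))
        (ℚ.≤-trans (ℚ.∣p-q∣≤∣p∣+∣q∣ (g D) (g D - τ))
          (ℚ.+-mono-≤ (ℚ.≤-reflexive (ℚ.0≤p⇒∣p∣≡p (ℚ.<⇒≤ 0<g[D]))) (ℚ.<⇒≤ near₂)))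
        where
        lem₄ : ∀ G τ → τ ≡ G - (G - τ)
        lem₄ = solve-∀ ℚ-ring
      step₂ : ℚ.∣ (s - (1ℚ + k * i)) * τ ∣ ≤ (g D + 1ℚ) * ε
      step₂ = ℚ.≤-trans (abs* (s - (1ℚ + k * i)) τ ∣τ∣≤)
        (ℚ.≤-trans (ℚ.*-monoʳ-≤-nonNeg (g D + 1ℚ) {{ℚ.nonNegative (0≤+ (ℚ.<⇒≤ 0<g[D]) 0≤1)}} (ℚ.<⇒≤ near₄))
          (ℚ.≤-reflexive (ℚ.*-comm ε (g D + 1ℚ))))
      lem₂ : ∀ s G k τ i → (s - 1ℚ) * G - k ≡ (s - 1ℚ) * (G - τ) + (s - (1ℚ + k * i)) * τ + k * (i * τ - 1ℚ)
      lem₂ = solve-∀ ℚ-ring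
      lem₃ : ∀ p q r ε → p * ε + q * ε + r * ε ≡ ε * (p + q + r)
      lem₃ = solve-∀ ℚ-ring

-- Grids from two equivalence relations

-- The least element of S; the second argument only excludes S = ∅
-- (the value is junk when it is not an element of S).
first : ∀ {n} → Subset n → Fin n → Fin n
first (inside ∷ S)  _       = zero
first (outside ∷ S) zero    = zero
first (outside ∷ S) (suc d) = suc (first S d)

first-∈ : ∀ {n} (S : Subset n) {d} → d ∈ S → first S d ∈ S
first-∈ (inside ∷ S)  _         = here
first-∈ (outside ∷ S) (there p) = there (first-∈ S p)

first-unique : ∀ {n} (S : Subset n) {d e} → d ∈ S → e ∈ S → first S d ≡ first S e
first-unique (inside ∷ S)  _         _         = refl
first-unique (outside ∷ S) (there p) (there q) = cong suc (first-unique S p q)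

enum : ∀ {n} (S : Subset n) → Fin ∣ S ∣ → Fin n
enum (inside ∷ S)  zero    = zero
enum (inside ∷ S)  (suc i) = suc (enum S i)
enum (outside ∷ S) i       = suc (enum S i)

-- Elements of a refinement type carry irrelevant proofs, so a position has to be computed without
-- inspecting the membership proof.
index : ∀ {n} (S : Subset n) x → .(x ∈ S) → Fin ∣ S ∣
index (inside ∷ S)  zero    _ = zero
index (inside ∷ S)  (suc x) p = suc (index S x (drop-there p))
index (outside ∷ S) zero    p = ⊥-elim-irr (outside-zero p)
  where
  outside-zero : ∀ {n} {S : Subset n} → zero ∉ outside ∷ S
  outside-zero ()
index (outside ∷ S) (suc x) p = index S x (drop-there p)

enum-∈ : ∀ {n} (S : Subset n) i → enum S i ∈ S
enum-∈ (inside ∷ S)  zero    = here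
enum-∈ (inside ∷ S)  (suc i) = there (enum-∈ S i)
enum-∈ (outside ∷ S) i       = there (enum-∈ S i)

enum-index : ∀ {n} (S : Subset n) {x} (p : x ∈ S) → enum S (index S x p) ≡ x
enum-index (inside ∷ S)  here      = refl
enum-index (inside ∷ S)  (there p) = cong suc (enum-index S p)
enum-index (outside ∷ S) (there p) = cong suc (enum-index S p)

index-enum : ∀ {n} (S : Subset n) i .(p : enum S i ∈ S) → index S (enum S i) p ≡ i
index-enum (inside ∷ S)  zero    _ = refl
index-enum (inside ∷ S)  (suc i) p = cong suc (index-enum S i (drop-there p))
index-enum (outside ∷ S) i       p = index-enum S i (drop-there p)

index-cong : ∀ {n} (S : Subset n) {x y} → x ≡ y → .(p : x ∈ S) .(q : y ∈ S) → index S x p ≡ index S y q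
index-cong S refl _ _ = refl

index-injective : ∀ {n} (S : Subset n) {x y} (p : x ∈ S) (q : y ∈ S) → index S x p ≡ index S y q → x ≡ y
index-injective S p q eq = trans (sym (enum-index S p)) (trans (cong (enum S) eq) (enum-index S q))

module Classes {n : ℕ} {P : Fin n → Set} {R : Fin n → Fin n → Set}
  (P? : Decidable P) (R? : ∀ y z → Dec (R y z))
  (R-refl : ∀ {y} → P y → R y y) (R-sym : ∀ {y z} → R y z → R z y)
  (R-trans : ∀ {x y z} → R x y → R y z → R x z) (R⇒P : ∀ {y z} → R y z → P z) where

  rep : Fin n → Fin n
  rep y = first ⟦ R? y ⟧ y

  R-rep : ∀ {y} → P y → R y (rep y)
  R-rep {y} py = ∈⟦⟧⁻ (R? y) (first-∈ ⟦ R? y ⟧ (∈⟦⟧⁺ (R? y) (R-refl py)))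

  -- Related elements have the same class as a subset, and its least element does not depend on the
  -- member that names it.
  rep-cong : ∀ {y z} → R y z → rep y ≡ rep z
  rep-cong {y} {z} r = trans (cong (λ S → first S y) S≡T)
    (first-unique ⟦ R? z ⟧ (∈⟦⟧⁺ (R? z) (R-sym r)) (∈⟦⟧⁺ (R? z) (R-refl (R⇒P r))))
    where
    S≡T : ⟦ R? y ⟧ ≡ ⟦ R? z ⟧
    S≡T = ⊆-antisym (λ p → ∈⟦⟧⁺ (R? z) (R-trans (R-sym r) (∈⟦⟧⁻ (R? y) p)))
                    (λ p → ∈⟦⟧⁺ (R? y) (R-trans r (∈⟦⟧⁻ (R? z) p)))

  rep-reflects : ∀ {y z} → P y → P z → rep y ≡ rep z → R y z
  rep-reflects py pz eq = R-trans (R-rep py) (R-sym (subst (R _) (sym eq) (R-rep pz)))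

  IsRep : Fin n → Set
  IsRep c = P c × rep c ≡ c

  IsRep? : Decidable IsRep
  IsRep? c = P? c ×-dec (rep c Fin.≟ c)

  Reps : Subset n
  Reps = ⟦ IsRep? ⟧

  rep-IsRep : ∀ {y} → P y → IsRep (rep y)
  rep-IsRep py = R⇒P (R-rep py) , sym (rep-cong (R-rep py))

  rep-∈ : ∀ {y} → P y → rep y ∈ Reps
  rep-∈ py = ∈⟦⟧⁺ IsRep? (rep-IsRep py)

  -- Each element of `Q` is charged to the unique representative of its class; exchanging the two
  -- sums then counts class by class.
  #-partition : ∀ {Q : Fin n → Set} (Q? : Decidable Q) {t} → (∀ {y} → Q y → P y) →
    (∀ {c} → P c → # (λ z → R? c z ×-dec Q? z) ≡ t) → # Q? ≡ ℕ→ℚ ∣ Reps ∣ * t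
  #-partition {Q} Q? {t} Q⇒P count = begin
    # Q?
      ≡⟨ sum-cong-≗ (λ z → one-rep z (Q? z)) ⟩
    sum (λ z → sum (λ c → ind (IsRep? c) * ind (R? c z ×-dec Q? z)))
      ≡⟨ ∑-comm (λ z c → ind (IsRep? c) * ind (R? c z ×-dec Q? z)) ⟩
    sum (λ c → sum (λ z → ind (IsRep? c) * ind (R? c z ×-dec Q? z)))
      ≡⟨ sum-cong-≗ (λ c → trans (sym (*-distribˡ-sum (ind (IsRep? c)) (λ z → ind (R? c z ×-dec Q? z)))) (per-class c (IsRep? c))) ⟩
    sum (λ c → ind (IsRep? c) * t)
      ≡⟨ sym (*-distribʳ-sum t (λ c → ind (IsRep? c))) ⟩
    # IsRep? * t
      ≡⟨ cong (_* t) (#-⟦⟧ IsRep?) ⟩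
    ℕ→ℚ ∣ Reps ∣ * t ∎
    where
    open ≡-Reasoning
    per-class : ∀ c (d : Dec (IsRep c)) → ind d * # (λ z → R? c z ×-dec Q? z) ≡ ind d * t
    per-class c (yes (pc , _)) = cong (1ℚ *_) (count pc)
    per-class c (no _)         = trans (ℚ.*-zeroˡ (# (λ z → R? c z ×-dec Q? z))) (sym (ℚ.*-zeroˡ t))
    one-rep : ∀ z (d : Dec (Q z)) → ind d ≡ sum (λ c → ind (IsRep? c) * ind (R? c z ×-dec d))
    one-rep z (yes q) = sym (trans (sum-cong-≗ (λ c → trans (sym (ind-× (IsRep? c) (R? c z ×-dec yes q)))
      (trans (ind-cong (IsRep? c ×-dec (R? c z ×-dec yes q)) (rep z Fin.≟ c)
        (λ ((_ , eq) , r , _) → trans (sym (rep-cong r)) eq)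
        (λ { refl → rep-IsRep (Q⇒P q) , R-sym (R-rep (Q⇒P q)) , q }))
        (sym (ℚ.*-identityʳ (ind (rep z Fin.≟ c))))))) (sum-δ (rep z) (λ _ → 1ℚ)))
    one-rep z (no ¬q) = sym (trans (sum-cong-≗ (λ c → trans (sym (ind-× (IsRep? c) (R? c z ×-dec no ¬q)))
      (ind-no (IsRep? c ×-dec (R? c z ×-dec no ¬q)) (λ (_ , _ , q) → ¬q q)))) (sum-replicate-zero n))

module Cells {n a : ℕ} {P : Fin n → Set} {R S : Fin n → Fin n → Set}
  (P? : Decidable P) (R? : ∀ y z → Dec (R y z)) (S? : ∀ y z → Dec (S y z))
  (R-refl : ∀ {y} → P y → R y y) (R-sym : ∀ {y z} → R y z → R z y)
  (R-trans : ∀ {x y z} → R x y → R y z → R x z) (R⇒P : ∀ {y z} → R y z → P z)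
  (S-refl : ∀ {y} → P y → S y y) (S-sym : ∀ {y z} → S y z → S z y)
  (S-trans : ∀ {x y z} → S x y → S y z → S x z) (S⇒P : ∀ {y z} → S y z → P z)
  (cell-size : ∀ {y y′} → P y → P y′ → # (λ z → R? y z ×-dec S? y′ z) ≡ ℕ→ℚ a) where

  module R = Classes P? R? R-refl R-sym R-trans R⇒P
  module S = Classes P? S? S-refl S-sym S-trans S⇒P

  cell : Fin n → Fin n → Subset n
  cell c l = ⟦ (λ z → R? c z ×-dec S? l z) ⟧

  ∣cell∣ : ∀ {c l} → P c → P l → ∣ cell c l ∣ ≡ a
  ∣cell∣ {c} {l} pc pl = ℕ→ℚ-injective (trans (sym (#-⟦⟧ (λ z → R? c z ×-dec S? l z))) (cell-size pc pl))

  ∈-cell : ∀ {y} → P y → y ∈ cell (R.rep y) (S.rep y)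
  ∈-cell {y} py = ∈⟦⟧⁺ (λ z → R? (R.rep y) z ×-dec S? (S.rep y) z) (R-sym (R.R-rep py) , S-sym (S.R-rep py))

  -- With irrelevant proofs the position depends on `c`, `l` and `z` only, so equalities of
  -- representatives can be matched with `refl`.
  cell-index : ∀ c l → .(P c) → .(P l) → ∀ z → .(z ∈ cell c l) → Fin a
  cell-index c l pc pl z p = Fin.cast (∣cell∣ pc pl) (index (cell c l) z p)

  cell-index-cong : ∀ {c c′ l l′ z z′} → c ≡ c′ → l ≡ l′ → z ≡ z′ →
    .(pc : P c) .(pl : P l) .(p : z ∈ cell c l) .(pc′ : P c′) .(pl′ : P l′) .(p′ : z′ ∈ cell c′ l′) →
    cell-index c l pc pl z p ≡ cell-index c′ l′ pc′ pl′ z′ p′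
  cell-index-cong refl refl refl _ _ _ _ _ _ = refl

  Target : Set
  Target = (Fin ∣ R.Reps ∣ × Fin ∣ S.Reps ∣) × Fin a

  to : [ y ∈ Fin n ∣ P y ] → Target
  to (y , [ py ]) = (index R.Reps (R.rep y) (R.rep-∈ py) , index S.Reps (S.rep y) (S.rep-∈ py)) ,
    cell-index (R.rep y) (S.rep y) (R⇒P (R.R-rep py)) (S⇒P (S.R-rep py)) y (∈-cell py)

  enumR-IsRep : ∀ i → R.IsRep (enum R.Reps i)
  enumR-IsRep i = ∈⟦⟧⁻ R.IsRep? (enum-∈ R.Reps i)

  enumS-IsRep : ∀ j → S.IsRep (enum S.Reps j)
  enumS-IsRep j = ∈⟦⟧⁻ S.IsRep? (enum-∈ S.Reps j)

  point : Target → Fin n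
  point ((i , j) , t) = enum (cell c l) (Fin.cast (sym (∣cell∣ (proj₁ (enumR-IsRep i)) (proj₁ (enumS-IsRep j)))) t)
    where
    c = enum R.Reps i
    l = enum S.Reps j

  point-∈ : ∀ i j t → R (enum R.Reps i) (point ((i , j) , t)) × S (enum S.Reps j) (point ((i , j) , t))
  point-∈ i j t = ∈⟦⟧⁻ (λ z → R? (enum R.Reps i) z ×-dec S? (enum S.Reps j) z) (enum-∈ (cell (enum R.Reps i) (enum S.Reps j)) _)

  from : Target → [ y ∈ Fin n ∣ P y ]
  from x@((i , j) , t) = point x , [ R⇒P (proj₁ (point-∈ i j t)) ]

  to-from : ∀ x → to (from x) ≡ x
  to-from ((i , j) , t) = cong₂ _,_ (cong₂ _,_
      (trans (index-cong R.Reps repR≡ (R.rep-∈ pz) (enum-∈ R.Reps i)) (index-enum R.Reps i (enum-∈ R.Reps i)))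
      (trans (index-cong S.Reps repS≡ (S.rep-∈ pz) (enum-∈ S.Reps j)) (index-enum S.Reps j (enum-∈ S.Reps j))))
    (trans (cell-index-cong repR≡ repS≡ refl (R⇒P (R.R-rep pz)) (S⇒P (S.R-rep pz)) (∈-cell pz) pc pl z∈)
      (trans (cong (Fin.cast (∣cell∣ pc pl)) (index-enum (cell c l) u z∈))
        (Fin.cast-involutive (∣cell∣ pc pl) (sym (∣cell∣ pc pl)) t)))
    where
    c = enum R.Reps i
    l = enum S.Reps j
    pc = proj₁ (enumR-IsRep i)
    pl = proj₁ (enumS-IsRep j)
    z = point ((i , j) , t)
    u = Fin.cast (sym (∣cell∣ pc pl)) t
    rs = point-∈ i j t
    pz = R⇒P (proj₁ rs)
    z∈ : z ∈ cell c l
    z∈ = enum-∈ (cell c l) u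
    repR≡ : R.rep z ≡ c
    repR≡ = trans (sym (R.rep-cong (proj₁ rs))) (proj₂ (enumR-IsRep i))
    repS≡ : S.rep z ≡ l
    repS≡ = trans (sym (S.rep-cong (proj₂ rs))) (proj₂ (enumS-IsRep j))

  enum-cell-index : ∀ {c c′ l l′} → c ≡ c′ → l ≡ l′ → (pc : P c) (pl : P l) (pc′ : P c′) (pl′ : P l′) →
    ∀ {z} (p : z ∈ cell c l) →
    enum (cell c′ l′) (Fin.cast (sym (∣cell∣ pc′ pl′)) (cell-index c l pc pl z p)) ≡ z
  enum-cell-index {c} {_} {l} refl refl pc pl pc′ pl′ {z} p = trans
    (cong (enum (cell c l)) (Fin.cast-involutive (sym (∣cell∣ pc′ pl′)) (∣cell∣ pc pl) (index (cell c l) z p)))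
    (enum-index (cell c l) p)

  from-to : ∀ y → from (to y) ≡ y
  from-to (y , [ irr ]) = value-injective (enum-cell-index (sym (enum-index R.Reps (R.rep-∈ py))) (sym (enum-index S.Reps (S.rep-∈ py)))
    (R⇒P (R.R-rep py)) (S⇒P (S.R-rep py))
    (proj₁ (enumR-IsRep (index R.Reps (R.rep y) (R.rep-∈ py))))
    (proj₁ (enumS-IsRep (index S.Reps (S.rep y) (S.rep-∈ py)))) (∈-cell py))
    where
    -- Only an irrelevant proof is at hand; decidability of `P` recovers a usable one.
    py : P y
    py = recompute (P? y) irr

  bijection : [ y ∈ Fin n ∣ P y ] ↔ Target
  bijection = mk↔ₛ′ to from to-from from-to

  R-column : ∀ {y z} → .(py : P y) .(pz : P z) → R y z →
    proj₁ (proj₁ (to (y , [ py ]))) ≡ proj₁ (proj₁ (to (z , [ pz ])))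
  R-column py pz r = index-cong R.Reps (R.rep-cong r) (R.rep-∈ py) (R.rep-∈ pz)

  S-row : ∀ {y z} → .(py : P y) .(pz : P z) → S y z →
    proj₂ (proj₁ (to (y , [ py ]))) ≡ proj₂ (proj₁ (to (z , [ pz ])))
  S-row py pz r = index-cong S.Reps (S.rep-cong r) (S.rep-∈ py) (S.rep-∈ pz)

  column-R : ∀ {y z} → (py : P y) (pz : P z) →
    proj₁ (proj₁ (to (y , [ py ]))) ≡ proj₁ (proj₁ (to (z , [ pz ]))) → R y z
  column-R py pz eq = R.rep-reflects py pz (index-injective R.Reps (R.rep-∈ py) (R.rep-∈ pz) eq)

  row-S : ∀ {y z} → (py : P y) (pz : P z) →
    proj₂ (proj₁ (to (y , [ py ]))) ≡ proj₂ (proj₁ (to (z , [ pz ]))) → S y z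
  row-S py pz eq = S.rep-reflects py pz (index-injective S.Reps (S.rep-∈ py) (S.rep-∈ pz) eq)

-- Lines and assemblies

module Geometry {n : ℕ} (Γ : FiniteGraph n) (dr : IsDistanceRegular Γ)
  (D : ℕ) (b : ℤ) (α β : ℚ) (classical : HasClassicalParameters Γ dr D b α β)
  (b≥2 : ℤ.+ 2 ℤ.≤ b) (α≥1 : 1ℚ ≤ α) (D≥3 : 3 ℕ.≤ D)
  (𝒞 : Pred (Subset n) 0ℓ) (geometric : IsGeometric Γ dr 𝒞) (dualPasch : DualPasch Γ 𝒞) where

  open FiniteGraph Γ
  open Spectrum Γ dr D b α β classical b≥2 α≥1 D≥3

  open IsGeometric geometric

  private
    line-by : ∀ {p q} → Dec (p ~ q) → Subset n
    line-by (yes p~q) = proj₁ (edge _ _ p~q)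
    line-by (no _)    = ∅

  -- Empty unless p and q are adjacent.
  line : Fin n → Fin n → Subset n
  line p q = line-by (p ~? q)

  ∈line⇒~ : ∀ {p q z} → z ∈ line p q → p ~ q
  ∈line⇒~ {p} {q} = go (p ~? q)
    where
    go : ∀ (d : Dec (p ~ q)) {z} → z ∈ line-by d → p ~ q
    go (yes p~q) _  = p~q
    go (no _)    z∈ = contradiction z∈ ∉⊥

  line-spec : ∀ {p q} → p ~ q → 𝒞 (line p q) × p ∈ line p q × q ∈ line p q
  line-spec {p} {q} p~q = go (p ~? q)
    where
    go : ∀ (d : Dec (p ~ q)) → 𝒞 (line-by d) × p ∈ line-by d × q ∈ line-by d
    go (yes e) = proj₁ (proj₂ (edge p q e))
    go (no ≁)  = contradiction p~q ≁

  line-𝒞 : ∀ {p q} → p ~ q → 𝒞 (line p q)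
  line-𝒞 p~q = proj₁ (line-spec p~q)

  ∈lineˡ : ∀ {p q} → p ~ q → p ∈ line p q
  ∈lineˡ p~q = proj₁ (proj₂ (line-spec p~q))

  ∈lineʳ : ∀ {p q} → p ~ q → q ∈ line p q
  ∈lineʳ p~q = proj₂ (proj₂ (line-spec p~q))

  line-clique : ∀ {ℓ p q} → 𝒞 ℓ → p ∈ ℓ → q ∈ ℓ → p ≢ q → p ~ q
  line-clique ℓ∈ = IsDelsarteClique.isClique (delsarte _ ℓ∈)

  lines-unique : ∀ {p q ℓ m} → p ~ q → 𝒞 ℓ → p ∈ ℓ → q ∈ ℓ → 𝒞 m → p ∈ m → q ∈ m → ℓ ≡ m
  lines-unique {p} {q} p~q ℓ∈ pℓ qℓ m∈ pm qm =
    trans (sym (proj₂ (proj₂ (edge p q p~q)) (ℓ∈ , pℓ , qℓ))) (proj₂ (proj₂ (edge p q p~q)) (m∈ , pm , qm))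

  line-unique : ∀ {p q ℓ} → p ~ q → 𝒞 ℓ → p ∈ ℓ → q ∈ ℓ → line p q ≡ ℓ
  line-unique p~q ℓ∈ p∈ q∈ = lines-unique p~q (line-𝒞 p~q) (∈lineˡ p~q) (∈lineʳ p~q) ℓ∈ p∈ q∈

  s : ℚ
  s = 1ℚ + β

  #-line : ∀ {ℓ} → 𝒞 ℓ → # (_∈? ℓ) ≡ s
  #-line {ℓ} ℓ∈ = trans (#-∈ ℓ) (delsarte-size (delsarte ℓ ℓ∈))

  0<β : 0ℚ < β
  0<β = subst (0ℚ <_) (trans (cong (λ p → β - α * p) (gaussian-zero {b} {HasClassicalParameters.b≢1 classical})) (lem α β))
    (β-αg>0 0 (ℕ.≤-trans (ℕ.s≤s ℕ.z≤n) D≥3))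
    where
    lem : ∀ α β → β - α * 0ℚ ≡ β
    lem = solve-∀ ℚ-ring

  0<s : 0ℚ < s
  0<s = 0<+ 0<1 (ℚ.<⇒≤ 0<β)

  other-point : ∀ {ℓ} → 𝒞 ℓ → ∀ x → ∃[ y ] y ∈ ℓ × y ≢ x
  other-point {ℓ} ℓ∈ x = decidable-stable (Fin.any? (λ y → (y ∈? ℓ) ×-dec ¬? (y Fin.≟ x))) λ none →
    ℚ.<-irrefl refl (ℚ.<-≤-trans (<-by β 0<β refl) (ℚ.≤-trans (ℚ.≤-reflexive (sym (#-line ℓ∈)))
      (ℚ.≤-trans (sum-mono-≤ (λ y → below y (y ∈? ℓ) λ y∈ → decidable-stable (x Fin.≟ y) λ x≢y → none (y , y∈ , x≢y ∘ sym)))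
        (ℚ.≤-reflexive (sum-δ x (λ _ → 1ℚ))))))
    where
    below : ∀ y (d : Dec (y ∈ ℓ)) → (y ∈ ℓ → x ≡ y) → ind d ≤ ind (x Fin.≟ y) * 1ℚ
    below y (yes y∈) f = ℚ.≤-reflexive (sym (trans (ℚ.*-identityʳ _) (ind-yes (x Fin.≟ y) (f y∈))))
    below y (no _)   f = subst (0ℚ ≤_) (sym (ℚ.*-identityʳ _)) (ind-nonneg (x Fin.≟ y))

  -- Zero sums on lines

  inc : Fin n → Fin n → Fin n → ℚ
  inc p q z = ind (z ∈? line p q)

  -- N z w counts the ordered adjacent pairs whose line contains z and w; this
  -- avoids enumerating the lines, membership in 𝒞 being undecidable.
  N : Fin n → Fin n → ℚ
  N z w = sum (λ p → sum (λ q → inc p q z * inc p q w))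

  -- A counted pair spans the line through `z` and `w`, so the count is that of ordered pairs of
  -- distinct points on one line, of size `s` = β + 1.
  N-adjacent : ∀ {z w} → z ~ w → N z w ≡ s * β
  N-adjacent {z} {w} z~w = begin
    N z w
      ≡⟨ sum-cong-≗ (λ p → sum-cong-≗ (λ q → pointwise p q)) ⟩
    sum (λ p → sum (λ q → ind (p ∈? ℓ) * (ind (q ∈? ℓ) - ind (p Fin.≟ q) * ind (q ∈? ℓ))))
      ≡⟨ sum-cong-≗ (λ p → sym (*-distribˡ-sum (ind (p ∈? ℓ)) (λ q → ind (q ∈? ℓ) - ind (p Fin.≟ q) * ind (q ∈? ℓ)))) ⟩
    sum (λ p → ind (p ∈? ℓ) * sum (λ q → ind (q ∈? ℓ) - ind (p Fin.≟ q) * ind (q ∈? ℓ)))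
      ≡⟨ sum-cong-≗ (λ p → cong (ind (p ∈? ℓ) *_) (trans
           (sum-distrib-- (λ q → ind (q ∈? ℓ)) (λ q → ind (p Fin.≟ q) * ind (q ∈? ℓ)))
           (cong₂ _-_ (#-line ℓ∈) (sum-δ p (λ q → ind (q ∈? ℓ)))))) ⟩
    sum (λ p → ind (p ∈? ℓ) * (s - ind (p ∈? ℓ)))
      ≡⟨ sum-cong-≗ (λ p → trans (lem₁ (ind (p ∈? ℓ)) s) (trans (cong (λ t → ind (p ∈? ℓ) * s - t) (ind-idem (p ∈? ℓ))) (lem₂ (ind (p ∈? ℓ)) β))) ⟩
    sum (λ p → ind (p ∈? ℓ) * β)
      ≡⟨ sym (*-distribʳ-sum β (λ p → ind (p ∈? ℓ))) ⟩
    # (_∈? ℓ) * β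
      ≡⟨ cong (_* β) (#-line ℓ∈) ⟩
    s * β ∎
    where
    open ≡-Reasoning
    ℓ = line z w
    ℓ∈ = line-𝒞 z~w
    lem₁ : ∀ i s → i * (s - i) ≡ i * s - i * i
    lem₁ = solve-∀ ℚ-ring
    lem₂ : ∀ i β → i * (1ℚ + β) - i ≡ i * β
    lem₂ = solve-∀ ℚ-ring
    lem₃ : ∀ i j k → i * (j * (1ℚ - k)) ≡ i * (j - k * j)
    lem₃ = solve-∀ ℚ-ring
    pointwise : ∀ p q → inc p q z * inc p q w ≡ ind (p ∈? ℓ) * (ind (q ∈? ℓ) - ind (p Fin.≟ q) * ind (q ∈? ℓ))
    pointwise p q = begin
      inc p q z * inc p q w
        ≡⟨ sym (ind-× (z ∈? line p q) (w ∈? line p q)) ⟩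
      ind ((z ∈? line p q) ×-dec (w ∈? line p q))
        ≡⟨ ind-cong ((z ∈? line p q) ×-dec (w ∈? line p q)) ((p ∈? ℓ) ×-dec ((q ∈? ℓ) ×-dec ¬? (p Fin.≟ q)))
             to from ⟩
      ind ((p ∈? ℓ) ×-dec ((q ∈? ℓ) ×-dec ¬? (p Fin.≟ q)))
        ≡⟨ trans (ind-× (p ∈? ℓ) ((q ∈? ℓ) ×-dec ¬? (p Fin.≟ q))) (cong (ind (p ∈? ℓ) *_)
             (trans (ind-× (q ∈? ℓ) (¬? (p Fin.≟ q))) (cong (ind (q ∈? ℓ) *_) (ind-¬ (p Fin.≟ q))))) ⟩
      ind (p ∈? ℓ) * (ind (q ∈? ℓ) * (1ℚ - ind (p Fin.≟ q)))
        ≡⟨ lem₃ (ind (p ∈? ℓ)) (ind (q ∈? ℓ)) (ind (p Fin.≟ q)) ⟩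
      ind (p ∈? ℓ) * (ind (q ∈? ℓ) - ind (p Fin.≟ q) * ind (q ∈? ℓ)) ∎
      where
      to : z ∈ line p q × w ∈ line p q → p ∈ ℓ × q ∈ ℓ × p ≢ q
      to (z∈ , w∈) = subst (p ∈_) (sym eq) (∈lineˡ p~q) , subst (q ∈_) (sym eq) (∈lineʳ p~q) , λ { refl → ~-irrefl p~q }
        where
        p~q = ∈line⇒~ z∈
        eq : ℓ ≡ line p q
        eq = line-unique z~w (line-𝒞 p~q) z∈ w∈
      from : p ∈ ℓ × q ∈ ℓ × p ≢ q → z ∈ line p q × w ∈ line p q
      from (p∈ , q∈ , p≢q) = subst (z ∈_) (sym eq) (∈lineˡ z~w) , subst (w ∈_) (sym eq) (∈lineʳ z~w)
        where
        p~q = line-clique ℓ∈ p∈ q∈ p≢q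
        eq : line p q ≡ ℓ
        eq = line-unique p~q ℓ∈ p∈ q∈

  N-distant : ∀ {z w} → z ≢ w → ¬ z ~ w → N z w ≡ 0ℚ
  N-distant {z} {w} z≢w z≁w = trans (sum-cong-≗ (λ p → trans (sum-cong-≗ (λ q →
    trans (sym (ind-× (z ∈? line p q) (w ∈? line p q))) (ind-no ((z ∈? line p q) ×-dec (w ∈? line p q))
      λ (z∈ , w∈) → z≁w (line-clique (line-𝒞 (∈line⇒~ z∈)) z∈ w∈ z≢w))))
    (sum-replicate-zero n))) (sum-replicate-zero n)

  N-decomposition : ∀ z w → N z w ≡ A Γ z w * (s * β) + ind (z Fin.≟ w) * N z z
  N-decomposition z w = go (z Fin.≟ w) (z ~? w)
    where
    lem₁ : ∀ p q → q ≡ 0ℚ * p + 1ℚ * q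
    lem₁ = solve-∀ ℚ-ring
    lem₂ : ∀ p q → p ≡ 1ℚ * p + 0ℚ * q
    lem₂ = solve-∀ ℚ-ring
    lem₃ : ∀ p q → 0ℚ ≡ 0ℚ * p + 0ℚ * q
    lem₃ = solve-∀ ℚ-ring
    go : (d : Dec (z ≡ w)) (e : Dec (z ~ w)) → N z w ≡ ind e * (s * β) + ind d * N z z
    go (yes refl) (yes z~z) = contradiction z~z ~-irrefl
    go (yes refl) (no _)    = lem₁ (s * β) (N z z)
    go (no _)     (yes z~w) = trans (N-adjacent z~w) (lem₂ (s * β) (N z z))
    go (no z≢w)   (no z≁w)  = trans (N-distant z≢w z≁w) (lem₃ (s * β) (N z z))

  sum-N : ∀ (f : Fin n → ℚ) z → sum (λ w → N z w * f w) ≡ s * β * sum (λ w → A Γ z w * f w) + N z z * f z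
  sum-N f z = begin
    sum (λ w → N z w * f w)
      ≡⟨ sum-cong-≗ (λ w → trans (cong (_* f w) (N-decomposition z w)) (lem (A Γ z w) (s * β) (ind (z Fin.≟ w)) (N z z) (f w))) ⟩
    sum (λ w → s * β * (A Γ z w * f w) + ind (z Fin.≟ w) * (N z z * f w))
      ≡⟨ ∑-distrib-+ (λ w → s * β * (A Γ z w * f w)) (λ w → ind (z Fin.≟ w) * (N z z * f w)) ⟩
    sum (λ w → s * β * (A Γ z w * f w)) + sum (λ w → ind (z Fin.≟ w) * (N z z * f w))
      ≡⟨ cong₂ _+_ (sym (*-distribˡ-sum (s * β) (λ w → A Γ z w * f w))) (sum-δ z (λ w → N z z * f w)) ⟩
    s * β * sum (λ w → A Γ z w * f w) + N z z * f z ∎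
    where
    open ≡-Reasoning
    lem : ∀ a c d m f → (a * c + d * m) * f ≡ c * (a * f) + d * (m * f)
    lem = solve-∀ ℚ-ring

  -- The lines through `z` are not counted. The row sum of `N` is found twice: as `s * N z z`, every
  -- line having `s` points, and as `s * β * k + N z z` by `sum-N`.
  N-diagonal : ∀ z → N z z ≡ k * s
  N-diagonal z = *-cancelˡ 0<β (trans (lem₁ β (N z z)) (trans (cong (_- N z z) (trans (sym total₁) total₂)) (lem₂ s β k (N z z))))
    where
    open ≡-Reasoning
    lem₁ : ∀ β m → β * m ≡ (1ℚ + β) * m - m
    lem₁ = solve-∀ ℚ-ring
    lem₂ : ∀ s β k m → s * β * k + m * 1ℚ - m ≡ β * (k * s)
    lem₂ = solve-∀ ℚ-ring
    inner : ∀ p q → sum (λ w → inc p q z * inc p q w) ≡ s * (inc p q z * inc p q z)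
    inner p q = trans (sym (*-distribˡ-sum (inc p q z) (λ w → inc p q w))) (trans (go (z ∈? line p q)) (cong (s *_) (sym (ind-idem (z ∈? line p q)))))
      where
      go : (d : Dec (z ∈ line p q)) → ind d * # (_∈? line p q) ≡ s * ind d
      go (yes z∈) = trans (ℚ.*-identityˡ (# (_∈? line p q))) (trans (#-line (line-𝒞 (∈line⇒~ z∈))) (sym (ℚ.*-identityʳ s)))
      go (no _)   = trans (ℚ.*-zeroˡ (# (_∈? line p q))) (sym (ℚ.*-zeroʳ s))
    total₁ : sum (λ w → N z w * 1ℚ) ≡ s * N z z
    total₁ = begin
      sum (λ w → N z w * 1ℚ)
        ≡⟨ sum-cong-≗ (λ w → ℚ.*-identityʳ (N z w)) ⟩
      sum (λ w → sum (λ p → sum (λ q → inc p q z * inc p q w)))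
        ≡⟨ ∑-comm (λ w p → sum (λ q → inc p q z * inc p q w)) ⟩
      sum (λ p → sum (λ w → sum (λ q → inc p q z * inc p q w)))
        ≡⟨ sum-cong-≗ (λ p → ∑-comm (λ w q → inc p q z * inc p q w)) ⟩
      sum (λ p → sum (λ q → sum (λ w → inc p q z * inc p q w)))
        ≡⟨ sum-cong-≗ (λ p → sum-cong-≗ (inner p)) ⟩
      sum (λ p → sum (λ q → s * (inc p q z * inc p q z)))
        ≡⟨ sum-cong-≗ (λ p → sym (*-distribˡ-sum s (λ q → inc p q z * inc p q z))) ⟩
      sum (λ p → s * sum (λ q → inc p q z * inc p q z))
        ≡⟨ sym (*-distribˡ-sum s (λ p → sum (λ q → inc p q z * inc p q z))) ⟩
      s * N z z ∎
    total₂ : sum (λ w → N z w * 1ℚ) ≡ s * β * k + N z z * 1ℚ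
    total₂ = trans (sum-N (λ _ → 1ℚ) z) (cong (λ t → s * β * t + N z z * 1ℚ)
      (trans (sum-cong-≗ (λ w → ℚ.*-identityʳ (A Γ z w))) (#-neighbours z)))

  module LineSum (f : Fin n → ℚ) (Af≡ : ∀ y → sum (λ z → A Γ y z * f z) ≡ - g D * f y) where

    S : Fin n → Fin n → ℚ
    S p q = sum (λ z → inc p q z * f z)

    -- Up to the factor s, this sum is fᵀ (β A + k) f = β fᵀ (A + [D]) f.
    sum-of-squares : sum (λ p → sum (λ q → S p q * S p q)) ≡ 0ℚ
    sum-of-squares = begin
      sum (λ p → sum (λ q → S p q * S p q))
        ≡⟨ sum-cong-≗ (λ p → sum-cong-≗ (λ q → expand p q)) ⟩
      sum (λ p → sum (λ q → sum (λ z → sum (λ w → X p q z w))))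
        ≡⟨ sum-cong-≗ (λ p → ∑-comm (λ q z → sum (λ w → X p q z w))) ⟩
      sum (λ p → sum (λ z → sum (λ q → sum (λ w → X p q z w))))
        ≡⟨ ∑-comm (λ p z → sum (λ q → sum (λ w → X p q z w))) ⟩
      sum (λ z → sum (λ p → sum (λ q → sum (λ w → X p q z w))))
        ≡⟨ sum-cong-≗ (λ z → sum-cong-≗ (λ p → ∑-comm (λ q w → X p q z w))) ⟩
      sum (λ z → sum (λ p → sum (λ w → sum (λ q → X p q z w))))
        ≡⟨ sum-cong-≗ (λ z → ∑-comm (λ p w → sum (λ q → X p q z w))) ⟩
      sum (λ z → sum (λ w → sum (λ p → sum (λ q → X p q z w))))
        ≡⟨ sum-cong-≗ (λ z → trans (sum-cong-≗ (λ w → collect z w)) (sym (*-distribˡ-sum (f z) (λ w → N z w * f w)))) ⟩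
      sum (λ z → f z * sum (λ w → N z w * f w))
        ≡⟨ sum-cong-≗ vanish ⟩
      sum {n} (λ z → 0ℚ)
        ≡⟨ sum-replicate-zero n ⟩
      0ℚ ∎
      where
      open ≡-Reasoning
      X : Fin n → Fin n → Fin n → Fin n → ℚ
      X p q z w = f z * f w * (inc p q z * inc p q w)
      lem₁ : ∀ j i f h → j * f * (i * h) ≡ f * h * (j * i)
      lem₁ = solve-∀ ℚ-ring
      lem₂ : ∀ f h m → f * h * m ≡ f * (m * h)
      lem₂ = solve-∀ ℚ-ring
      lem₃ : ∀ f s β G → f * (s * β * (- G * f) + G * β * s * f) ≡ 0ℚ
      lem₃ = solve-∀ ℚ-ring
      expand : ∀ p q → S p q * S p q ≡ sum (λ z → sum (λ w → X p q z w))
      expand p q = trans (*-distribʳ-sum (S p q) (λ z → inc p q z * f z)) (sum-cong-≗ (λ z →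
        trans (*-distribˡ-sum (inc p q z * f z) (λ w → inc p q w * f w))
              (sum-cong-≗ (λ w → lem₁ (inc p q z) (inc p q w) (f z) (f w)))))
      collect : ∀ z w → sum (λ p → sum (λ q → X p q z w)) ≡ f z * (N z w * f w)
      collect z w = trans (sum-cong-≗ (λ p → sym (*-distribˡ-sum (f z * f w) (λ q → inc p q z * inc p q w))))
        (trans (sym (*-distribˡ-sum (f z * f w) (λ p → sum (λ q → inc p q z * inc p q w)))) (lem₂ (f z) (f w) (N z w)))
      vanish : ∀ z → f z * sum (λ w → N z w * f w) ≡ 0ℚ
      vanish z = trans (cong (f z *_) (trans (sum-N f z) (cong₂ (λ t m → s * β * t + m * f z) (Af≡ z)
        (trans (N-diagonal z) (cong (_* s) k-formula))))) (lem₃ (f z) s β (g D))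

    S-zero : ∀ p q → S p q ≡ 0ℚ
    S-zero p q = square-zero (S p q) (sum-zero⇒zero (λ q → square-nonneg (S p q))
      (sum-zero⇒zero (λ p → sum-nonneg (λ q → square-nonneg (S p q))) sum-of-squares p) q)

    line-sum : ∀ {ℓ x} → 𝒞 ℓ → x ∈ ℓ → sum (λ z → ind (z ∈? ℓ) * f z) ≡ 0ℚ
    line-sum {ℓ} {x} ℓ∈ x∈ = subst (λ m → sum (λ z → ind (z ∈? m) * f z) ≡ 0ℚ)
      (line-unique (line-clique ℓ∈ x∈ (proj₁ (proj₂ other)) (proj₂ (proj₂ other) ∘ sym)) ℓ∈ x∈ (proj₁ (proj₂ other)))
      (S-zero x (proj₁ other))
      where other = other-point ℓ∈ x

  on-line? : ∀ ℓ x → Decidable (λ z → z ∈ ℓ × x ~ z)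
  on-line? ℓ x z = (z ∈? ℓ) ×-dec (x ~? z)

  -- The neighbour `y` keeps all of `ℓ` at distance 1 or 2 from `x`. The zero sum over `ℓ` is then
  -- one linear equation in the number of neighbours, solved by the recurrence for `w` at index 1.
  #-neighbours-on-line : ∀ {x y ℓ} → 𝒞 ℓ → x ∉ ℓ → y ∈ ℓ → x ~ y → # (on-line? ℓ x) ≡ 1ℚ + α
  #-neighbours-on-line {x} {y} {ℓ} ℓ∈ x∉ y∈ x~y = *-cancelˡ (0<* 0<s (w>0 1)) (begin
    s * w 1 * G
      ≡⟨ lem₁ (w 1) α β G ⟩
    (β - α * 1ℚ) * w 1 * G + (1ℚ + α * 1ℚ) * w 1 * G
      ≡⟨ cong (λ t → (β - α * 1ℚ) * w 1 * G + t * G) (sym rec) ⟩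
    (β - α * 1ℚ) * w 1 * G + (β - α * 1ℚ) * w 2 * G
      ≡⟨ lem₂ (β - α * 1ℚ) (w 1) (w 2) G s ⟩
    (β - α * 1ℚ) * w 2 * s - (β - α * 1ℚ) * (G * (v 1 - v 2) + s * v 2)
      ≡⟨ cong₂ (λ t u → t * s - (β - α * 1ℚ) * u) rec (trans (sym sum≡) (LineSum.line-sum (λ z → v (dist x z)) (A-v x) ℓ∈ y∈)) ⟩
    (1ℚ + α * 1ℚ) * w 1 * s - (β - α * 1ℚ) * 0ℚ
      ≡⟨ lem₃ α β (w 1) s ⟩
    s * w 1 * (1ℚ + α) ∎)
    where
    open ≡-Reasoning
    G = # (on-line? ℓ x)

    rec : (β - α * 1ℚ) * w 2 ≡ (1ℚ + α * 1ℚ) * w 1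
    rec = subst (λ p → (β - α * p) * w 2 ≡ (1ℚ + α * p) * w 1) g-one (w-rec 1 (ℕ.≤-trans (ℕ.s≤s (ℕ.s≤s ℕ.z≤n)) D≥3))
    lem₁ : ∀ w α β G → (1ℚ + β) * w * G ≡ (β - α * 1ℚ) * w * G + (1ℚ + α * 1ℚ) * w * G
    lem₁ = solve-∀ ℚ-ring
    lem₂ : ∀ r u t G s → r * u * G + r * t * G ≡ r * t * s - r * (G * ((- 1ℚ) * u - (- - 1ℚ) * t) + s * ((- - 1ℚ) * t))
    lem₂ = solve-∀ ℚ-ring
    lem₃ : ∀ α β w s → (1ℚ + α * 1ℚ) * w * s - (β - α * 1ℚ) * 0ℚ ≡ s * w * (1ℚ + α)
    lem₃ = solve-∀ ℚ-ring
    lem₄ : ∀ p q → 1ℚ * p ≡ 1ℚ * 1ℚ * (p - q) + 1ℚ * q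
    lem₄ = solve-∀ ℚ-ring
    lem₅ : ∀ p q → 1ℚ * q ≡ 1ℚ * 0ℚ * (p - q) + 1ℚ * q
    lem₅ = solve-∀ ℚ-ring
    lem₆ : ∀ p q i t → 0ℚ * t ≡ 0ℚ * i * (p - q) + 0ℚ * q
    lem₆ = solve-∀ ℚ-ring
    dist≡2 : ∀ {z} → z ∈ ℓ → ¬ x ~ z → dist x z ≡ 2
    dist≡2 {z} z∈ x≁z = ℕ.≤-antisym
      (subst (λ i → dist x z ℕ.≤ suc i) (~⇒dist≡1 x~y)
        (dist-step-≤ x (line-clique ℓ∈ y∈ z∈ λ { refl → x≁z x~y })))
      (ℕ.≤∧≢⇒< (ℕ.n≢0⇒n>0 λ e → x∉ (subst (_∈ ℓ) (sym (dist≡0⇒≡ e)) z∈)) λ e → x≁z (dist≡1⇒~ (sym e)))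
    pointwise : ∀ z (d : Dec (z ∈ ℓ)) (e : Dec (x ~ z)) → ind d * v (dist x z) ≡ ind d * ind e * (v 1 - v 2) + ind d * v 2
    pointwise z (yes z∈) (yes x~z) = trans (cong (λ i → 1ℚ * v i) (~⇒dist≡1 x~z)) (lem₄ (v 1) (v 2))
    pointwise z (yes z∈) (no x≁z)  = trans (cong (λ i → 1ℚ * v i) (dist≡2 z∈ x≁z)) (lem₅ (v 1) (v 2))
    pointwise z (no _)   e         = lem₆ (v 1) (v 2) (ind e) (v (dist x z))
    sum≡ : sum (λ z → ind (z ∈? ℓ) * v (dist x z)) ≡ G * (v 1 - v 2) + s * v 2
    sum≡ = trans (sum-cong-≗ (λ z → trans (pointwise z (z ∈? ℓ) (x ~? z))
             (cong (λ i → i * (v 1 - v 2) + ind (z ∈? ℓ) * v 2) (sym (ind-× (z ∈? ℓ) (x ~? z))))))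
      (trans (∑-distrib-+ (λ z → ind (on-line? ℓ x z) * (v 1 - v 2)) (λ z → ind (z ∈? ℓ) * v 2))
        (cong₂ _+_ (sym (*-distribʳ-sum (v 1 - v 2) (λ z → ind (on-line? ℓ x z))))
          (trans (sym (*-distribʳ-sum (v 2) (λ z → ind (z ∈? ℓ)))) (cong (_* v 2) (#-line ℓ∈)))))

  -- Crossing points in the local graph

  module At (x : Fin n) where

    infix 4 _∥_ _⌢_ _≈_

    -- Adjacency of `x` and `y` is implicit, as `line x y` is empty otherwise. The first component
    -- excludes `z = x`.
    _∥_ : Fin n → Fin n → Set
    y ∥ z = x ~ z × z ∈ line x y

    _⌢_ : Fin n → Fin n → Set
    y ⌢ z = x ~ y × x ~ z × y ~ z × z ∉ line x y

    line-eq : ∀ {y z} → y ∥ z → line x y ≡ line x z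
    line-eq (x~z , z∈) = sym (line-unique x~z (line-𝒞 x~y) (∈lineˡ x~y) z∈)
      where x~y = ∈line⇒~ z∈

    ∥⇒~ : ∀ {y z} → y ∥ z → x ~ y
    ∥⇒~ (_ , z∈) = ∈line⇒~ z∈

    ∥-refl : ∀ {y} → x ~ y → y ∥ y
    ∥-refl x~y = x~y , ∈lineʳ x~y

    ∥-sym : ∀ {y z} → y ∥ z → z ∥ y
    ∥-sym {y} y∥z = ∥⇒~ y∥z , subst (y ∈_) (line-eq y∥z) (∈lineʳ (∥⇒~ y∥z))

    ∥-trans : ∀ {y z t} → y ∥ z → z ∥ t → y ∥ t
    ∥-trans {t = t} y∥z (x~t , t∈) = x~t , subst (t ∈_) (sym (line-eq y∥z)) t∈

    ⌢⇒∦ : ∀ {y z} → y ⌢ z → ¬ y ∥ z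
    ⌢⇒∦ (_ , _ , _ , z∉) (_ , z∈) = z∉ z∈

    ⌢-intro : ∀ {y z} → x ~ y → x ~ z → y ~ z → ¬ y ∥ z → y ⌢ z
    ⌢-intro x~y x~z y~z ∦ = x~y , x~z , y~z , λ z∈ → ∦ (x~z , z∈)

    ⌢-sym : ∀ {y z} → y ⌢ z → z ⌢ y
    ⌢-sym y⌢z@(x~y , x~z , y~z , _) = ⌢-intro x~z x~y (~-sym y~z) (⌢⇒∦ y⌢z ∘ ∥-sym)

    ⌢-pasch : ∀ {y z w} → y ⌢ z → y ⌢ w → z ≢ w → z ~ w
    ⌢-pasch {y} {z} {w} (x~y , x~z , y~z , z∉) (_ , x~w , y~w , w∉) z≢w =
      dualPasch x y (line x y) x~y (line-𝒞 x~y) (∈lineˡ x~y) (∈lineʳ x~y) z w (x~z , y~z , z∉) (x~w , y~w , w∉) z≢w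

    ∥-adjacent : ∀ {y z} → y ∥ z → y ≢ z → y ~ z
    ∥-adjacent y∥z@(_ , z∈) y≢z = line-clique (line-𝒞 (∥⇒~ y∥z)) (∈lineʳ (∥⇒~ y∥z)) z∈ y≢z

    infix 4 _∥?_ _⌢?_

    _∥?_ : ∀ y z → Dec (y ∥ z)
    y ∥? z = (x ~? z) ×-dec (z ∈? line x y)

    _⌢?_ : ∀ y z → Dec (y ⌢ z)
    y ⌢? z = (x ~? y) ×-dec ((x ~? z) ×-dec ((y ~? z) ×-dec ¬? (z ∈? line x y)))

    remove-x : ∀ {P : Fin n → Set} (P? : Decidable P) → P x → # P? ≡ 1ℚ + # (λ z → ¬? (x Fin.≟ z) ×-dec P? z)
    remove-x {P} P? px = begin
      # P?
        ≡⟨ sum-cong-≗ (λ z → pointwise z (x Fin.≟ z)) ⟩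
      sum (λ z → ind (x Fin.≟ z) * 1ℚ + ind (¬? (x Fin.≟ z) ×-dec P? z))
        ≡⟨ ∑-distrib-+ (λ z → ind (x Fin.≟ z) * 1ℚ) (λ z → ind (¬? (x Fin.≟ z) ×-dec P? z)) ⟩
      sum (λ z → ind (x Fin.≟ z) * 1ℚ) + # (λ z → ¬? (x Fin.≟ z) ×-dec P? z)
        ≡⟨ cong (_+ # (λ z → ¬? (x Fin.≟ z) ×-dec P? z)) (sum-δ x (λ _ → 1ℚ)) ⟩
      1ℚ + # (λ z → ¬? (x Fin.≟ z) ×-dec P? z) ∎
      where
      open ≡-Reasoning
      pointwise : ∀ z (d : Dec (x ≡ z)) → ind (P? z) ≡ ind d * 1ℚ + ind (¬? d ×-dec P? z)
      pointwise z (yes refl) = ind-yes (P? x) px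
      pointwise z (no _)     = trans (sym (ℚ.+-identityˡ (ind (P? z)))) (cong (_+ ind (P? z)) (sym (ℚ.*-zeroˡ 1ℚ)))

    #-∥ : ∀ {y} → x ~ y → # (y ∥?_) ≡ β
    #-∥ {y} x~y = trans
      (#-cong (y ∥?_) (λ z → ¬? (x Fin.≟ z) ×-dec (z ∈? line x y))
        (λ z (x~z , z∈) → (λ { refl → ~-irrefl x~z }) , z∈)
        (λ z (x≢z , z∈) → line-clique (line-𝒞 x~y) (∈lineˡ x~y) z∈ x≢z , z∈))
      (1+-injective (trans (sym (remove-x (_∈? line x y) (∈lineˡ x~y))) (#-line (line-𝒞 x~y))))

    cross? : ∀ y m → Decidable (λ z → x ~ z × y ~ z × z ∈ line x m)
    cross? y m z = (x ~? z) ×-dec ((y ~? z) ×-dec (z ∈? line x m))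

    -- Of the α + 1 neighbours of `y` on the line, `x` itself is one.
    #-cross : ∀ {y m} → x ~ y → x ~ m → ¬ m ∥ y → # (cross? y m) ≡ α
    #-cross {y} {m} x~y x~m ∦ = trans
      (#-cong (cross? y m) (λ z → ¬? (x Fin.≟ z) ×-dec on-line? (line x m) y z)
        (λ z (x~z , y~z , z∈) → (λ { refl → ~-irrefl x~z }) , z∈ , y~z)
        (λ z (x≢z , z∈ , y~z) → line-clique (line-𝒞 x~m) (∈lineˡ x~m) z∈ x≢z , y~z , z∈))
      (1+-injective (trans (sym (remove-x (on-line? (line x m) y) (∈lineˡ x~m , ~-sym x~y)))
        (#-neighbours-on-line (line-𝒞 x~m) (λ y∈ → ∦ (x~y , y∈)) (∈lineˡ x~m) (~-sym x~y))))

    #-pos⇒∃ : ∀ {P : Fin n → Set} (P? : Decidable P) → 0ℚ < # P? → ∃ P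
    #-pos⇒∃ P? 0<# = decidable-stable (Fin.any? P?) λ none → ℚ.<-irrefl
      (sym (trans (sum-cong-≗ (λ z → ind-no (P? z) (λ pz → none (z , pz)))) (sum-replicate-zero n))) 0<#

    -- The valency [D] β exceeds 2 β, the number of neighbours on two lines.
    third-line : ∀ y z → ∃[ t ] x ~ t × ¬ y ∥ t × ¬ z ∥ t
    third-line y z = decidable-stable (Fin.any? (λ t → (x ~? t) ×-dec (¬? (y ∥? t) ×-dec ¬? (z ∥? t)))) λ none →
      ℚ.<-irrefl refl (begin-strict
        β + β                        <⟨ <-by β 0<β refl ⟩
        β + β + β                    ≤⟨ ≤-by ((g D - three) * β) (0≤* (p≤q⇒0≤q-p three≤g[D]) (ℚ.<⇒≤ 0<β)) (lem β (g D)) ⟩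
        g D * β                      ≡⟨ sym k-formula ⟩
        k                            ≡⟨ sym (#-neighbours x) ⟩
        # (x ~?_)                    ≤⟨ sum-mono-≤ (λ t → cover t (x ~? t) (y ∥? t) (z ∥? t) λ x~t ∦y ∦z → none (t , x~t , ∦y , ∦z)) ⟩
        sum (λ t → ind (y ∥? t) + ind (z ∥? t)) ≡⟨ ∑-distrib-+ (λ t → ind (y ∥? t)) (λ t → ind (z ∥? t)) ⟩
        # (y ∥?_) + # (z ∥?_)        ≤⟨ ℚ.+-mono-≤ (#-∥≤β y) (#-∥≤β z) ⟩
        β + β                        ∎)
      where
      open ℚ.≤-Reasoning
      three = 1ℚ + 1ℚ + 1ℚ
      three≤g[D] : three ≤ g D
      three≤g[D] = ℚ.≤-trans (ℚ.+-monoˡ-≤ 1ℚ (ℚ.≤-trans (ℚ.+-monoˡ-≤ 1ℚ (ℚ.≤-reflexive (sym g-one))) (g-step 1)))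
        (ℚ.≤-trans (g-step 2) (g-mono-≤ D≥3))
      lem : ∀ β G → β + β + β + (G - (1ℚ + 1ℚ + 1ℚ)) * β ≡ G * β
      lem = solve-∀ ℚ-ring
      #-∥≤β : ∀ y → # (y ∥?_) ≤ β
      #-∥≤β y = go (x ~? y)
        where
        go : Dec (x ~ y) → # (y ∥?_) ≤ β
        go (yes x~y) = ℚ.≤-reflexive (#-∥ x~y)
        go (no x≁y)  = subst (_≤ β) (sym (trans (sum-cong-≗ (λ z → ind-no (y ∥? z) (x≁y ∘ ∥⇒~))) (sum-replicate-zero n))) (ℚ.<⇒≤ 0<β)
      cover : ∀ t (d : Dec (x ~ t)) (e : Dec (y ∥ t)) (f : Dec (z ∥ t)) →
        (x ~ t → ¬ y ∥ t → ¬ z ∥ t → ⊥) → ind d ≤ ind e + ind f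
      cover t (no _)    e         f         _ = 0≤+ (ind-nonneg e) (ind-nonneg f)
      cover t (yes _)   (yes _)   f         _ = ≤-by (ind f) (ind-nonneg f) refl
      cover t (yes _)   (no _)    (yes _)   _ = ℚ.≤-refl
      cover t (yes x~t) (no ∦y)   (no ∦z)   h = ⊥-elim (h x~t ∦y ∦z)

    -- A line through `x` other than those of `y` and `z` carries α ≥ 1 points crossing `y`.
    cross-off : ∀ {y} → x ~ y → ∀ z → ∃[ t ] y ⌢ t × ¬ z ∥ t
    cross-off {y} x~y z = t , ⌢-intro x~y x~t y~t (λ y∥t → ∦y (∥-trans y∥t t∥u)) , λ z∥t → ∦z (∥-trans z∥t t∥u)
      where
      u = proj₁ (third-line y z)
      x~u = proj₁ (proj₂ (third-line y z))
      ∦y = proj₁ (proj₂ (proj₂ (third-line y z)))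
      ∦z = proj₂ (proj₂ (proj₂ (third-line y z)))
      crossing : ∃[ t ] x ~ t × y ~ t × t ∈ line x u
      crossing = #-pos⇒∃ (cross? y u) (subst (0ℚ <_) (sym (#-cross x~y x~u (∦y ∘ ∥-sym))) (ℚ.<-≤-trans 0<1 α≥1))
      t = proj₁ crossing
      x~t = proj₁ (proj₂ crossing)
      y~t = proj₁ (proj₂ (proj₂ crossing))
      t∥u : t ∥ u
      t∥u = ∥-sym (x~t , proj₂ (proj₂ (proj₂ crossing)))

    -- When z and w are on one line through x, the argument detours through a
    -- point t on a third line.
    ⌢-transfer : ∀ {y y′ z w} → y ∥ y′ → y ⌢ z → y′ ⌢ z → y ⌢ w → y′ ⌢ w
    ⌢-transfer {y} {y′} y∥y′ y⌢z y′⌢z y⌢w = go (_ ∥? _)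
      where
      off : ∀ {z w} → y ⌢ z → y′ ⌢ z → y ⌢ w → ¬ z ∥ w → y′ ⌢ w
      off {z} {w} y⌢z y′⌢z y⌢w ∦ = ⌢-intro (proj₁ y∥y′) (proj₁ (proj₂ y⌢w))
        (⌢-pasch (⌢-sym y′⌢z) z⌢w (λ { refl → ⌢⇒∦ y⌢w y∥y′ })) (λ y′∥w → ⌢⇒∦ y⌢w (∥-trans y∥y′ y′∥w))
        where
        z⌢w : z ⌢ w
        z⌢w = ⌢-intro (proj₁ (proj₂ y⌢z)) (proj₁ (proj₂ y⌢w))
          (⌢-pasch y⌢z y⌢w (λ { refl → ∦ (∥-refl (proj₁ (proj₂ y⌢z))) })) ∦
      go : Dec (_ ∥ _) → y′ ⌢ _
      go (no ∦)    = off y⌢z y′⌢z y⌢w ∦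
      go (yes z∥w) = off y⌢t (off y⌢z y′⌢z y⌢t ∦) y⌢w (λ t∥w → ∦ (∥-trans z∥w (∥-sym t∥w)))
        where
        third = cross-off (proj₁ y⌢z) _
        y⌢t = proj₁ (proj₂ third)
        ∦ = proj₂ (proj₂ third)

    -- y ≈ z means that the assemblies containing x, y and x, z coincide.
    _≈_ : Fin n → Fin n → Set
    y ≈ z = y ⌢ z ⊎ (y ∥ z × ∃[ w ] y ⌢ w × z ⌢ w)

    _≈?_ : ∀ y z → Dec (y ≈ z)
    y ≈? z = (y ⌢? z) ⊎-dec ((y ∥? z) ×-dec Fin.any? (λ w → (y ⌢? w) ×-dec (z ⌢? w)))

    ≈-refl : ∀ {y} → x ~ y → y ≈ y
    ≈-refl {y} x~y = inj₂ (∥-refl x~y , proj₁ c , proj₁ (proj₂ c) , proj₁ (proj₂ c))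
      where c = cross-off x~y y

    ≈-sym : ∀ {y z} → y ≈ z → z ≈ y
    ≈-sym (inj₁ y⌢z)                   = inj₁ (⌢-sym y⌢z)
    ≈-sym (inj₂ (y∥z , w , y⌢w , z⌢w)) = inj₂ (∥-sym y∥z , w , z⌢w , y⌢w)

    ≈⇒~ : ∀ {y z} → y ≈ z → x ~ z
    ≈⇒~ (inj₁ (_ , x~z , _))    = x~z
    ≈⇒~ (inj₂ ((x~z , _) , _)) = x~z

    -- Two points crossing `z` either cross each other, by the dual Pasch axiom, or share a line and
    -- have `z` as common witness. The other cases slide a crossing along a line with `⌢-transfer`.
    ≈-trans : ∀ {y z t} → y ≈ z → z ≈ t → y ≈ t
    ≈-trans {y} {z} {t} (inj₁ y⌢z) (inj₁ z⌢t) = go (y ∥? t)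
      where
      go : Dec (y ∥ t) → y ≈ t
      go (yes y∥t) = inj₂ (y∥t , z , y⌢z , ⌢-sym z⌢t)
      go (no ∦)    = inj₁ (⌢-intro (proj₁ y⌢z) (proj₁ (proj₂ z⌢t))
        (⌢-pasch (⌢-sym y⌢z) z⌢t λ { refl → ∦ (∥-refl (proj₁ y⌢z)) }) ∦)
    ≈-trans (inj₁ y⌢z) (inj₂ (z∥t , w , z⌢w , t⌢w)) = inj₁ (⌢-sym (⌢-transfer z∥t z⌢w t⌢w (⌢-sym y⌢z)))
    ≈-trans (inj₂ (y∥z , w , y⌢w , z⌢w)) (inj₁ z⌢t) = inj₁ (⌢-transfer (∥-sym y∥z) z⌢w y⌢w z⌢t)
    ≈-trans (inj₂ (y∥z , w , y⌢w , z⌢w)) (inj₂ (z∥t , u , z⌢u , t⌢u)) =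
      inj₂ (∥-trans y∥z z∥t , u , ⌢-transfer (∥-sym y∥z) z⌢w y⌢w z⌢u , t⌢u)

    -- Off the line of `m`, the class of `y` meets that line in the points crossing `y`. If `y` is
    -- on it, nothing there crosses `y`, and an auxiliary `q` crossing `y` replaces it.
    #-cell : ∀ {y m} → x ~ y → x ~ m → # (λ z → (y ≈? z) ×-dec (m ∥? z)) ≡ α
    #-cell {y} {m} x~y x~m = go (m ∥? y)
      where
      go : Dec (m ∥ y) → # (λ z → (y ≈? z) ×-dec (m ∥? z)) ≡ α
      go (no ∦) = trans (#-cong (λ z → (y ≈? z) ×-dec (m ∥? z)) (cross? y m)
        (λ { z (inj₁ (_ , _ , y~z , _) , x~z , z∈) → x~z , y~z , z∈
           ; z (inj₂ (y∥z , _) , m∥z) → contradiction (∥-trans m∥z (∥-sym y∥z)) ∦ })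
        (λ z (x~z , y~z , z∈) → inj₁ (⌢-intro x~y x~z y~z (λ y∥z → ∦ (∥-trans (x~z , z∈) (∥-sym y∥z)))) , x~z , z∈))
        (#-cross x~y x~m ∦)
      go (yes m∥y) = trans (#-cong (λ z → (y ≈? z) ×-dec (m ∥? z)) (cross? q m)
        (λ { z (inj₁ y⌢z , m∥z) → contradiction (∥-trans (∥-sym m∥y) m∥z) (⌢⇒∦ y⌢z)
           ; z (inj₂ (y∥z , u , y⌢u , z⌢u) , x~z , z∈) →
               x~z , ~-sym (proj₁ (proj₂ (proj₂ (⌢-transfer y∥z y⌢u z⌢u y⌢q)))) , z∈ })
        (λ z (x~z , q~z , z∈) → let y∥z = ∥-trans (∥-sym m∥y) (x~z , z∈) in
           inj₂ (y∥z , q , y⌢q , ⌢-intro x~z x~q (~-sym q~z) (λ z∥q → ⌢⇒∦ y⌢q (∥-trans y∥z z∥q))) , x~z , z∈))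
        (#-cross x~q x~m (λ m∥q → ⌢⇒∦ y⌢q (∥-trans (∥-sym m∥y) m∥q)))
        where
        q = proj₁ (cross-off x~y y)
        y⌢q = proj₁ (proj₂ (cross-off x~y y))
        x~q = proj₁ (proj₂ y⌢q)

    ~⇒≈⊎∥ : ∀ {y z} → x ~ y → x ~ z → y ~ z → y ≈ z ⊎ y ∥ z
    ~⇒≈⊎∥ {y} {z} x~y x~z y~z = go (y ∥? z)
      where
      go : Dec (y ∥ z) → y ≈ z ⊎ y ∥ z
      go (yes y∥z) = inj₂ y∥z
      go (no ∦)    = inj₁ (inj₁ (⌢-intro x~y x~z y~z ∦))

    ≈-adjacent : ∀ {y z} → y ≈ z → y ≢ z → y ~ z
    ≈-adjacent (inj₁ (_ , _ , y~z , _)) _   = y~z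
    ≈-adjacent (inj₂ (y∥z , _))         y≢z = ∥-adjacent y∥z y≢z

  -- Assemblies through a vertex

  module Through {M : Subset n} (assembly : IsAssembly Γ 𝒞 M) {x : Fin n} (x∈M : x ∈ M) where
    open At x

    M-clique : IsClique Γ M
    M-clique = proj₁ (proj₁ assembly)

    -- Lines are cliques, so maximality would turn the inclusion into equality and make `M` a line.
    ⊈line : ∀ {ℓ} → 𝒞 ℓ → ¬ M ⊆ ℓ
    ⊈line ℓ∈ M⊆ℓ = proj₂ assembly
      (subst 𝒞 (⊆-antisym (proj₂ (proj₁ assembly) _ (line-clique ℓ∈) M⊆ℓ) M⊆ℓ) ℓ∈)

    -- If no two points of `M` crossed at `x`, all of `M` would lie on one line.
    crossing : ∃[ y ] ∃[ z ] y ∈ M × z ∈ M × y ⌢ z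
    crossing = decidable-stable (Fin.any? λ y → Fin.any? λ z → (y ∈? M) ×-dec ((z ∈? M) ×-dec (y ⌢? z)))
      λ none → go none (Fin.any? λ y → (y ∈? M) ×-dec ¬? (x Fin.≟ y))
      where
      go : ¬ (∃[ y ] ∃[ z ] y ∈ M × z ∈ M × y ⌢ z) → ¬ Dec (∃[ y ] y ∈ M × x ≢ y)
      go none (yes (y , y∈M , x≢y)) = ⊈line (line-𝒞 x~y) within
        where
        x~y = M-clique x∈M y∈M x≢y
        within : M ⊆ line x y
        within {t} t∈M = decidable-stable (t ∈? line x y) λ t∉ → none (y , t , y∈M , t∈M ,
          x~y , M-clique x∈M t∈M (λ { refl → t∉ (∈lineˡ x~y) }) , M-clique y∈M t∈M (λ { refl → t∉ (∈lineʳ x~y) }) , t∉)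
      -- Here `M` consists of `x` only, and any line through `x` contains it.
      go none (no single) = ⊈line (line-𝒞 x~t) λ {z} z∈M →
        subst (_∈ line x t) (decidable-stable (x Fin.≟ z) λ x≢z → single (z , z∈M , x≢z)) (∈lineˡ x~t)
        where
        t = proj₁ (third-line x x)
        x~t = proj₁ (proj₂ (third-line x x))

    y : Fin n
    y = proj₁ crossing

    y∈M : y ∈ M
    y∈M = proj₁ (proj₂ (proj₂ crossing))

    x~y : x ~ y
    x~y = proj₁ (proj₂ (proj₂ (proj₂ (proj₂ crossing))))

    ∈M⇒≈ : ∀ {t} → t ∈ M → x ≢ t → y ≈ t
    ∈M⇒≈ {t} t∈M x≢t = go (y ∥? t)
      where
      z = proj₁ (proj₂ crossing)
      z∈M = proj₁ (proj₂ (proj₂ (proj₂ crossing)))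
      y⌢z = proj₂ (proj₂ (proj₂ (proj₂ crossing)))
      x~t = M-clique x∈M t∈M x≢t
      go : Dec (y ∥ t) → y ≈ t
      go (yes y∥t) = inj₂ (y∥t , z , y⌢z , ⌢-intro x~t (proj₁ (proj₂ y⌢z))
        (M-clique t∈M z∈M λ { refl → ⌢⇒∦ y⌢z y∥t }) (λ t∥z → ⌢⇒∦ y⌢z (∥-trans y∥t t∥z)))
      go (no ∦)    = inj₁ (⌢-intro x~y x~t (M-clique y∈M t∈M λ { refl → ∦ (∥-refl x~y) }) ∦)

    -- The class of `y` with `x` added is a clique containing `M`; maximality gives the reverse
    -- inclusion.
    ≈⇒∈M : ∀ {t} → y ≈ t → t ∈ M
    ≈⇒∈M y≈t = proj₂ (proj₁ assembly) ⟦ T? ⟧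
      (λ p∈ q∈ p≢q → T-clique (∈⟦⟧⁻ T? p∈) (∈⟦⟧⁻ T? q∈) p≢q)
      (λ {t} t∈M → ∈⟦⟧⁺ T? (M⊆T t∈M (x Fin.≟ t))) (∈⟦⟧⁺ T? (inj₂ y≈t))
      where
      T : Fin n → Set
      T t = x ≡ t ⊎ y ≈ t
      T? : Decidable T
      T? t = (x Fin.≟ t) ⊎-dec (y ≈? t)
      M⊆T : ∀ {t} → t ∈ M → Dec (x ≡ t) → T t
      M⊆T t∈M (yes x≡t) = inj₁ x≡t
      M⊆T t∈M (no x≢t)  = inj₂ (∈M⇒≈ t∈M x≢t)
      T-clique : ∀ {p q} → T p → T q → p ≢ q → p ~ q
      T-clique (inj₁ refl) (inj₁ refl) p≢q = contradiction refl p≢q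
      T-clique (inj₁ refl) (inj₂ y≈q)  _   = ≈⇒~ y≈q
      T-clique (inj₂ y≈p)  (inj₁ refl) _   = ~-sym (≈⇒~ y≈p)
      T-clique (inj₂ y≈p)  (inj₂ y≈q)  p≢q = ≈-adjacent (≈-trans (≈-sym y≈p) y≈q) p≢q

    ∣line∩M∣ : ∀ {ℓ} → 𝒞 ℓ → x ∈ ℓ → ℕ→ℚ ∣ ℓ ∩ M ∣ ≡ α + 1ℚ
    ∣line∩M∣ {ℓ} ℓ∈ x∈ℓ = begin
      ℕ→ℚ ∣ ℓ ∩ M ∣
        ≡⟨ sym (#-∈ (ℓ ∩ M)) ⟩
      # (_∈? (ℓ ∩ M))
        ≡⟨ remove-x (_∈? (ℓ ∩ M)) (x∈p∩q⁺ (x∈ℓ , x∈M)) ⟩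
      1ℚ + # (λ z → ¬? (x Fin.≟ z) ×-dec (z ∈? (ℓ ∩ M)))
        ≡⟨ cong (λ p → 1ℚ + p) (#-cong (λ z → ¬? (x Fin.≟ z) ×-dec (z ∈? (ℓ ∩ M))) (λ z → (y ≈? z) ×-dec (o ∥? z))
             (λ z (x≢z , z∈) → let (z∈ℓ , z∈M) = x∈p∩q⁻ ℓ M z∈ in
               ∈M⇒≈ z∈M x≢z , line-clique ℓ∈ x∈ℓ z∈ℓ x≢z , subst (z ∈_) (sym line≡ℓ) z∈ℓ)
             (λ z (y≈z , x~z , z∈) → (λ { refl → ~-irrefl x~z }) , x∈p∩q⁺ (subst (z ∈_) line≡ℓ z∈ , ≈⇒∈M y≈z))) ⟩
      1ℚ + # (λ z → (y ≈? z) ×-dec (o ∥? z))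
        ≡⟨ cong (λ p → 1ℚ + p) (#-cell x~y x~o) ⟩
      1ℚ + α
        ≡⟨ ℚ.+-comm 1ℚ α ⟩
      α + 1ℚ ∎
      where
      open ≡-Reasoning
      other = other-point ℓ∈ x
      o = proj₁ other
      x~o : x ~ o
      x~o = line-clique ℓ∈ x∈ℓ (proj₁ (proj₂ other)) (proj₂ (proj₂ other) ∘ sym)
      line≡ℓ : line x o ≡ ℓ
      line≡ℓ = line-unique x~o ℓ∈ x∈ℓ (proj₁ (proj₂ other))

    -- Otherwise `u` would cross `t` at `x` and so belong to the class that makes up `M`.
    neighbour-on-line : ∀ {u t} → u ∉ M → u ~ x → t ∈ M → u ~ t → t ∈ line x u
    neighbour-on-line {u} {t} u∉M u~x t∈M u~t = go (x Fin.≟ t) (u ∥? t)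
      where
      x~u = ~-sym u~x
      go : Dec (x ≡ t) → Dec (u ∥ t) → t ∈ line x u
      go (yes refl) _         = ∈lineˡ x~u
      go (no _)    (yes u∥t) = proj₂ u∥t
      go (no x≢t)  (no ∦)    = contradiction
        (≈⇒∈M (≈-trans (∈M⇒≈ t∈M x≢t) (≈-sym (inj₁ (⌢-intro x~u (M-clique x∈M t∈M x≢t) u~t ∦))))) u∉M

  line-meets-assembly : (ℓ M : Subset n) → 𝒞 ℓ → IsAssembly Γ 𝒞 M → Nonempty (ℓ ∩ M) → ℕ→ℚ ∣ ℓ ∩ M ∣ ≡ α + 1ℚ
  line-meets-assembly ℓ M ℓ∈ assembly (x , x∈) =
    Through.∣line∩M∣ assembly (proj₂ (x∈p∩q⁻ ℓ M x∈)) ℓ∈ (proj₁ (x∈p∩q⁻ ℓ M x∈))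

  -- By `neighbour-on-line`, all neighbours of `u` in `M` lie on the line joining `u` to the given
  -- one, so both claims reduce to the intersection of that line with `M`.
  neighbours-in-assembly : (M : Subset n) (u : Fin n) → IsAssembly Γ 𝒞 M → u ∉ M → (∃[ z ] z ∈ M × u ~ z) →
    (∃[ s ] (λ z → z ∈ M × u ~ z) HasSize s × ℕ→ℚ s ≡ α + 1ℚ)
    × ∃! _≡_ (λ ℓ → 𝒞 ℓ × u ∈ ℓ × Nonempty (ℓ ∩ M))
  neighbours-in-assembly M u assembly u∉M (x , x∈M , u~x) =
    (∣ ℓ ∩ M ∣ , (ℓ ∩ M , (λ t → mk⇔ to from) , refl) , ∣line∩M∣ ℓ∈ (∈lineˡ x~u)) ,
    ℓ , (ℓ∈ , ∈lineʳ x~u , x , x∈p∩q⁺ (∈lineˡ x~u , x∈M)) , unique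
    where
    open Through assembly x∈M
    x~u = ~-sym u~x
    ℓ = line x u
    ℓ∈ = line-𝒞 x~u
    u≁∈M : ∀ {t} → t ∈ M → u ≢ t
    u≁∈M t∈M refl = u∉M t∈M
    to : ∀ {t} → t ∈ ℓ ∩ M → t ∈ M × u ~ t
    to t∈ = let (t∈ℓ , t∈M) = x∈p∩q⁻ ℓ M t∈ in t∈M , line-clique ℓ∈ (∈lineʳ x~u) t∈ℓ (u≁∈M t∈M)
    from : ∀ {t} → t ∈ M × u ~ t → t ∈ ℓ ∩ M
    from (t∈M , u~t) = x∈p∩q⁺ (neighbour-on-line u∉M u~x t∈M u~t , t∈M)
    unique : ∀ {m} → 𝒞 m × u ∈ m × Nonempty (m ∩ M) → ℓ ≡ m
    unique {m} (m∈ , u∈m , t , t∈) = lines-unique u~t ℓ∈ (∈lineʳ x~u) (neighbour-on-line u∉M u~x t∈M u~t) m∈ u∈m t∈m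
      where
      t∈m = proj₁ (x∈p∩q⁻ m M t∈)
      t∈M = proj₂ (x∈p∩q⁻ m M t∈)
      u~t = line-clique m∈ u∈m t∈m (u≁∈M t∈M)

  -- The local graph as a clique extension of a grid

  x₀ : Fin n
  x₀ = proj₁ (IsDistanceRegular.attained dr)

  neighbour : ∀ x → ∃[ y ] x ~ y
  neighbour x = proj₁ (At.third-line x x x) , proj₁ (proj₂ (At.third-line x x x))

  -- The rational α is a natural number because it is the size of a cell.
  α∈ℕ : ∃[ a ] ℕ→ℚ a ≡ α
  α∈ℕ = ∣ ⟦ cell? ⟧ ∣ , trans (sym (#-⟦⟧ cell?)) (#-cell (proj₂ (neighbour x₀)) (proj₂ (neighbour x₀)))
    where
    open At x₀
    y = proj₁ (neighbour x₀)
    cell? : Decidable (λ z → y ≈ z × y ∥ z)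
    cell? z = (y ≈? z) ×-dec (y ∥? z)

  a : ℕ
  a = proj₁ α∈ℕ

  module LocalIso (x : Fin n) where
    open At x
    open Cells {a = a} (x ~?_) _≈?_ _∥?_ ≈-refl ≈-sym ≈-trans ≈⇒~ ∥-refl ∥-sym ∥-trans proj₁
      (λ x~y x~m → trans (#-cell x~y x~m) (sym (proj₂ α∈ℕ))) public

    columns : ℕ
    columns = ∣ R.Reps ∣

    rows : ℕ
    rows = ∣ S.Reps ∣

    -- The β points other than `x` on one line through `x` split into cells of size α, one for each
    -- class.
    columns*α : ℕ→ℚ columns * α ≡ β
    columns*α = trans (sym (R.#-partition (y ∥?_) proj₁ (λ x~c → #-cell x~c x~y))) (#-∥ x~y)
      where
      y = proj₁ (neighbour x)
      x~y = proj₂ (neighbour x)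

    -- The k = [D]β neighbours of `x` are partitioned by the lines through `x`, with β on each.
    rows≡ : ℕ→ℚ rows ≡ g D
    rows≡ = *-cancelˡ 0<β (trans (ℚ.*-comm β (ℕ→ℚ rows)) (trans
      (sym (S.#-partition (x ~?_) (λ x~y → x~y) (λ x~c → trans
        (#-cong (λ z → (_ ∥? z) ×-dec (x ~? z)) (_ ∥?_) (λ _ → proj₁) (λ _ c∥z → c∥z , proj₁ c∥z)) (#-∥ x~c))))
      (trans (#-neighbours x) (trans k-formula (ℚ.*-comm (g D) β)))))

    column : [ y ∈ Fin n ∣ x ~ y ] → Fin columns
    column y = proj₁ (proj₁ (to y))

    row : [ y ∈ Fin n ∣ x ~ y ] → Fin rows
    row y = proj₂ (proj₁ (to y))

    place : [ y ∈ Fin n ∣ x ~ y ] → Fin a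
    place y = proj₂ (to y)

    Adjacent : (Fin columns × Fin rows) × Fin a → (Fin columns × Fin rows) × Fin a → Set
    Adjacent = Graph._~_ (cliqueExtension a (grid columns rows))

    to-injective : ∀ {y z} → column y ≡ column z → row y ≡ row z → place y ≡ place z → y ≡ z
    to-injective {y} {z} c l i = trans (sym (from-to y)) (trans (cong from (cong₂ _,_ (cong₂ _,_ c l) i)) (from-to z))

    neighbour-of-x : (y : [ y ∈ Fin n ∣ x ~ y ]) → x ~ value y
    neighbour-of-x (y , [ irr ]) = recompute (x ~? y) irr

    ~⇒adjacent : ∀ y z → value y ~ value z → Adjacent (to y) (to z)
    ~⇒adjacent y z y~z = go (column y Fin.≟ column z) (row y Fin.≟ row z)
      where
      x~y = neighbour-of-x y
      x~z = neighbour-of-x z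
      split : value y ≈ value z ⊎ value y ∥ value z → column y ≢ column z → row y ≢ row z → ⊥
      split (inj₁ y≈z) c _ = c (R-column x~y x~z y≈z)
      split (inj₂ y∥z) _ l = l (S-row x~y x~z y∥z)
      go : Dec (column y ≡ column z) → Dec (row y ≡ row z) → Adjacent (to y) (to z)
      go (yes c) (yes l) = inj₂ (cong₂ _,_ c l ,
        λ i≡j → ~-irrefl {value z} (subst (_~ value z) (cong value (to-injective {y} {z} c l i≡j)) y~z))
      go (yes c) (no l)  = inj₁ (inj₁ (c , l))
      go (no c)  (yes l) = inj₁ (inj₂ (c , l))
      go (no c)  (no l)  = ⊥-elim (split (~⇒≈⊎∥ x~y x~z y~z) c l)

    adjacent⇒~ : ∀ y z → Adjacent (to y) (to z) → value y ~ value z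
    adjacent⇒~ y z = go
      where
      x~y = neighbour-of-x y
      x~z = neighbour-of-x z
      go : Adjacent (to y) (to z) → value y ~ value z
      go (inj₁ (inj₁ (c , l))) = ≈-adjacent (column-R x~y x~z c) (λ eq → l (cong row (value-injective {v = y} {w = z} eq)))
      go (inj₁ (inj₂ (c , l))) = ∥-adjacent (row-S x~y x~z l) (λ eq → c (cong column (value-injective {v = y} {w = z} eq)))
      go (inj₂ (p , i≢j))      = ≈-adjacent (column-R x~y x~z (cong proj₁ p)) (λ eq → i≢j (cong place (value-injective {v = y} {w = z} eq)))

    isomorphism : localGraph graph x ≅ cliqueExtension a (grid columns rows)
    isomorphism = record { bijection = bijection ; adjacency = λ y z → mk⇔ (~⇒adjacent y z) (adjacent⇒~ y z) }

  module X₀ = LocalIso x₀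

  ℕ→ℚ-columns : .{{_ : ℚ.NonZero α}} → ℕ→ℚ X₀.columns ≡ β ℚ.÷ α
  ℕ→ℚ-columns = trans (sym (ℚ.*-identityʳ m)) (trans (cong (m *_) (sym (ℚ.*-inverseʳ α)))
    (trans (sym (ℚ.*-assoc m α (ℚ.1/ α))) (cong (_* ℚ.1/ α) X₀.columns*α)))
    where m = ℕ→ℚ X₀.columns

  -- The grid must be the same at all vertices. Its dimensions are taken at `x₀`; elsewhere the same
  -- counting equations determine them.
  local-structure : ∀ x → localGraph graph x ≅ cliqueExtension a (grid X₀.columns X₀.rows)
  local-structure x = subst₂ (λ m r → localGraph graph x ≅ cliqueExtension a (grid m r))
    (ℕ→ℚ-injective (*-cancelˡ (ℚ.<-≤-trans 0<1 α≥1) (trans (ℚ.*-comm α (ℕ→ℚ X.columns)) (trans X.columns*α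
      (trans (sym X₀.columns*α) (ℚ.*-comm (ℕ→ℚ X₀.columns) α))))))
    (ℕ→ℚ-injective (trans X.rows≡ (sym X₀.rows≡)))
    X.isomorphism
    where module X = LocalIso x

open import Data.Integer.Base using (+_)

theorem24 : ∀ {n : ℕ} (Γ : FiniteGraph n) (dr : IsDistanceRegular Γ)
    (D : ℕ) (b : ℤ) (α β : ℚ)
    (classical : HasClassicalParameters Γ dr D b α β)
    (b≥2 : + 2 ℤ.≤ b) (α≤b-1 : α ℚ.≤ ℤ→ℚ (b ℤ.- 1ℤ)) (α≥1 : 1ℚ ℚ.≤ α)
    (D≥3 : 3 ℕ.≤ D)
    (𝒞 : Pred (Subset n) 0ℓ) (geometric : IsGeometric Γ dr 𝒞)
    (dualPasch : DualPasch Γ 𝒞) →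
    let open FiniteGraph Γ in
    ((ℓ M : Subset n) → 𝒞 ℓ → IsAssembly Γ 𝒞 M →
    Nonempty (ℓ ∩ M) → ℕ→ℚ ∣ ℓ ∩ M ∣ ≡ α ℚ.+ 1ℚ)
    ×
    ((M : Subset n) (u : Fin n) → IsAssembly Γ 𝒞 M → u ∉ M →
    (∃[ z ] z ∈ M × u ~ z) →
    (∃[ s ] (λ z → z ∈ M × u ~ z) HasSize s × ℕ→ℚ s ≡ α ℚ.+ 1ℚ)
    × ∃! _≡_ (λ ℓ → 𝒞 ℓ × u ∈ ℓ × Nonempty (ℓ ∩ M)))
    ×
    (∃[ a ] ∃[ m ] ∃[ r ]
    ℕ→ℚ a ≡ α
    × ℕ→ℚ m ≡ ℚ._÷_ β α {{≥1⇒nonZero α≥1}}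
    × ℕ→ℚ r ≡ gaussian b (≥2⇒≢1 b≥2) D
    × ((x : Fin n) → localGraph graph x ≅ cliqueExtension a (grid m r)))
theorem24 Γ dr D b α β classical b≥2 α≤b-1 α≥1 D≥3 𝒞 geometric dualPasch =
  line-meets-assembly , neighbours-in-assembly ,
  a , X₀.columns , X₀.rows , proj₂ α∈ℕ , ℕ→ℚ-columns {{≥1⇒nonZero α≥1}} , X₀.rows≡ , local-structure
  where open Geometry Γ dr D b α β classical b≥2 α≥1 D≥3 𝒞 geometric dualPasch
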